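{- Assume the following hypothesis (the Conjecture): there is an integer $m_0$ such that for every integer $m\ge m_0$, whenever $\varepsilon_1,\dots,\varepsilon_{24}\in\{1,-1\}$ and positive integers $x_1,\dots,x_{24}$ satisfy $$\varepsilon_1 x_1^m + \varepsilon_2 x_2^m + \cdots + \varepsilon_{24} x_{24}^m = 0,$$ the solution is trivial. Then there exist an absolute constant $c>0$, an absolute constant $C>0$ and an integer $n_0$ such that for every $n\ge n_0$ and every set $S$ of $n$ positive integers, $$|S.S| < n^{1+c} \quad\Longrightarrow\quad |S+S| \ge C n^2 .$$
   Context: For a finite set $S$ of integers, $S.S := \{st : s,t\in S\}$ and $S+S := \{s+t : s,t\in S\}$. A solution $(\varepsilon_i,x_i)_{1\le i\le 24}$ of the displayed equation is called trivial if the indices $1,\dots,24$ can be partitioned into pairs $\{i,j\}$ such that $x_i=x_j$ and $\varepsilon_i=-\varepsilon_j$ for each pair (i.e. each term $\varepsilon_i x_i^m$ is paired with its negative). -}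

module Defs where

open import Algebra.Definitions using (Involutive)
open import Data.Fin using (Fin)
open import Data.Integer as ℤ using (ℤ; 0ℤ; _◃_)
open import Data.Integer.Properties using (+-0-monoid)
open import Data.List using (List; length; deduplicate; cartesianProductWith)
open import Data.List.Relation.Unary.All using (All)
open import Data.List.Relation.Unary.Unique.DecPropositional.Properties using (deduplicate-!)
open import Data.List.Relation.Unary.Unique.Propositional using (Unique)
open import Data.Nat using (ℕ; _+_; _*_; _^_; _≤_; _<_; _≟_)
open import Data.Product using (Σ-syntax; ∃-syntax; _×_)
open import Data.Rational as ℚ using (ℚ; ↥_; ↧ₙ_)
open import Data.Sign using (Sign; opposite)
open import Relation.Binary.PropositionalEquality using (_≡_; _≢_)

open import Algebra.Properties.Monoid.Sum +-0-monoid using (sum-syntax)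

record FinSet : Set where
  field
    elements : List ℕ
    unique   : Unique elements

open FinSet public

∣_∣ : FinSet → ℕ
∣ S ∣ = length (elements S)

AllPositive : FinSet → Set
AllPositive S = All (0 <_) (elements S)

image₂ : (ℕ → ℕ → ℕ) → FinSet → FinSet → FinSet
image₂ f S T = record
  { elements = deduplicate _≟_ values
  ; unique   = deduplicate-! _≟_ values
  }
  where
  values : List ℕ
  values = cartesianProductWith f (elements S) (elements T)

infixl 6 _⊕_
infixl 7 _⊙_

_⊕_ : FinSet → FinSet → FinSet
_⊕_ = image₂ _+_

_⊙_ : FinSet → FinSet → FinSet
_⊙_ = image₂ _*_

-- The sign s is read as ±1, and s ◃ a is the integer ±a.
signedPowerSum : ∀ {k} → ℕ → (Fin k → Sign) → (Fin k → ℕ) → ℤ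
signedPowerSum {k} m ε x = ∑[ i < k ] (ε i ◃ x i ^ m)

-- A partition of the indices into two-element blocks {i , j}, given by the
-- map sending each index to the other member of its block.
record Pairing (k : ℕ) : Set where
  field
    partner            : Fin k → Fin k
    partner-involutive : Involutive _≡_ partner
    partner-distinct   : ∀ i → partner i ≢ i

open Pairing public

Trivial : ∀ {k} → (Fin k → Sign) → (Fin k → ℕ) → Set
Trivial {k} ε x = Σ[ π ∈ Pairing k ] (∀ i →
  x i ≡ x (partner π i) × ε i ≡ opposite (ε (partner π i)))

Conjecture : Set
Conjecture = ∃[ m₀ ] ∀ m → m₀ ≤ m →
  (ε : Fin 24 → Sign) (x : Fin 24 → ℕ) → (∀ i → 0 < x i) →
  signedPowerSum m ε x ≡ 0ℤ → Trivial ε x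

-- For c = p / q ≥ 0 in lowest terms, a < n ^ (1 + c) is a ^ q < n ^ (q + p).
-- The absolute value makes this meaningless for negative c.
infix 4 _<_^[1+_]

_<_^[1+_] : ℕ → ℕ → ℚ → Set
a < n ^[1+ c ] = a ^ ↧ₙ c < n ^ (↧ₙ c + ℤ.∣ ↥ c ∣)

fromℕ : ℕ → ℚ
fromℕ n = ℤ.+ n ℚ./ 1

{-# OPTIONS --safe #-}

-- Write x ∼ y when x / y is an m-th power of a rational. If ρ runs over
-- representatives of the classes met by S, the products ρ sᵐ are distinct, so
-- by Plünnecke's inequality S meets only r classes, where r⁴ < n.
-- Suppose a + x = y + z with a fixed, x, y, z in fixed classes and a ≠ y, z. For
-- any four such solutions the determinant with rows (1 , x , y , z) vanishes, and
-- up to a common factor its 24 terms are ± m-th powers; by the conjecture the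
-- diagonal term equals an odd one. The 3 × 3 determinants bound by 2 the number
-- of solutions on which x, y, z or one of their ratios is constant, so among 19
-- solutions four can be chosen greedily whose diagonal term is unmatched.
-- Hence all but O(n r³) of the n² pairs (a , x) have a sum whose only
-- representations are a + x and x + a.

module Submission where

open import Defs
open import Algebra.Bundles using (AbelianGroup)
open import Data.Empty using (⊥)
open import Data.Fin using (Fin; suc; remQuot; remainder)
open import Data.Fin.Patterns
open import Data.Integer as ℤ using (ℤ; 0ℤ; 1ℤ; -1ℤ; _◃_)
import Data.Integer.Properties as ℤ
open import Data.Integer.Solver using () renaming (module +-*-Solver to ℤ-Solver)
open import Data.List
  using (List; []; _∷_; _++_; length; filter; map; deduplicate; cartesianProduct; cartesianProductWith)
import Data.List as List
open import Data.List.Properties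
  using (length-++; length-map; filter-complete; cartesianProductWith-zeroʳ)
open import Data.List.Membership.Propositional using (_∈_; find)
open import Data.List.Membership.Propositional.Properties
open import Data.List.Relation.Binary.Subset.Propositional using (_⊆_)
open import Data.List.Relation.Unary.All as All using (All; []; _∷_; all?)
import Data.List.Relation.Unary.All.Properties as All
open import Data.List.Relation.Unary.AllPairs as AllPairs using (AllPairs; []; _∷_)
open import Data.List.Relation.Unary.Any using (Any; here; there; any?)
open import Data.List.Relation.Unary.Unique.Propositional using (Unique)
import Data.List.Relation.Unary.Unique.Propositional.Properties as Unique
open import Data.Nat
  using (ℕ; zero; suc; _+_; _*_; _^_; _≤_; _<_; _≟_; _<?_; z≤n; s≤s; z<s; s≤s⁻¹;
         NonZero; >-nonZero; ≢-nonZero; ≢-nonZero⁻¹)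
open import Data.Nat.Coprimality using (Coprime; coprime-divisor; coprime-/gcd; 1-coprimeTo)
open import Data.Nat.Divisibility
  using (_∣_; divides; ∣-trans; m∣m*n; *-cancelʳ-∣; ∣1⇒≡1)
open import Data.Nat.DivMod using (_/_; m/n*n≡m)
open import Data.Nat.GCD using (gcd; gcd[m,n]∣m; gcd[m,n]∣n; gcd[m,n]≢0)
open import Data.Nat.Properties
open import Data.Nat.Solver using () renaming (module +-*-Solver to ℕ-Solver)
open import Data.Product using (Σ-syntax; ∃-syntax; _×_; _,_; proj₁; proj₂; swap)
open import Data.Rational using (ℚ; 0ℚ; mkℚ) renaming (_<_ to _<ℚ_; _≤_ to _≤ℚ_; _*_ to _*ℚ_)
import Data.Rational as ℚ
import Data.Rational.Properties as ℚ
open import Data.Rational.Unnormalised as ℚᵘ using (mkℚᵘ; *≤*)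
import Data.Rational.Unnormalised.Properties as ℚᵘ
open import Data.Sign as Sign using (Sign; opposite)
open import Data.Sum using (_⊎_; inj₁; inj₂; [_,_]′)
open import Data.Vec using ([]; _∷_; lookup)
import Data.Vec.Functional as Vector
open import Function using (_∘_)
open import Relation.Binary using (tri<; tri≈; tri>)
open import Relation.Binary.PropositionalEquality
open import Relation.Nullary using (¬_; Dec; yes; no; ¬?; _×-dec_; contradiction)
open import Relation.Nullary.Decidable using (map′)
open import Relation.Unary using (Decidable)

open import Algebra.Properties.CommutativeSemigroup *-commutativeSemigroup using (xy∙z≈xz∙y)
open import Algebra.Properties.Group (AbelianGroup.group ℤ.+-0-abelianGroup)
  using (∙-cancelˡ; ∙-cancelʳ)
open import Algebra.Properties.Monoid.Sum ℤ.+-0-monoid using (sum-syntax; sum-cong-≗)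
open import Algebra.Properties.Semiring.Sum ℤ.+-*-semiring using (*-distribˡ-sum)
open import Data.List.Membership.DecPropositional _≟_ using (_∈?_)
open import Data.List.Relation.Unary.Unique.DecPropositional.Properties _≟_ using (deduplicate-!)

-- Counting in lists

private variable
  U V : Set
  P Q : U → Set

length-filter-¬ : (P? : Decidable P) (xs : List U) →
  length (filter P? xs) + length (filter (¬? ∘ P?) xs) ≡ length xs
length-filter-¬ P? [] = refl
length-filter-¬ P? (x ∷ xs) with P? x
... | yes _ = cong suc (length-filter-¬ P? xs)
... | no  _ = trans (+-suc _ _) (cong suc (length-filter-¬ P? xs))

length-filter-filter : (P? : Decidable P) (Q? : Decidable Q) (xs : List U) →
  length (filter P? (filter Q? xs)) ≤ length (filter P? xs)
length-filter-filter P? Q? [] = z≤n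
length-filter-filter P? Q? (x ∷ xs) with Q? x
... | yes _ with P? x
...   | yes _ = s≤s (length-filter-filter P? Q? xs)
...   | no  _ = length-filter-filter P? Q? xs
length-filter-filter P? Q? (x ∷ xs) | no _ with P? x
...   | yes _ = m≤n⇒m≤1+n (length-filter-filter P? Q? xs)
...   | no  _ = length-filter-filter P? Q? xs

-- Union bound by induction on `is`: discarding the elements related to the first `b` costs at most
-- `k` of them, and the bounds for the other members of `is` survive filtering.
uncovered : ∀ {k} (R : V → U → Set) (R? : ∀ b → Decidable (R b)) (is : List V) {xs : List U} →
  All (λ b → length (filter (R? b) xs) ≤ k) is → length is * k < length xs →
  ∃[ x ] x ∈ xs × All (λ b → ¬ R b x) is
uncovered R R? [] {x ∷ _} [] _ = x , here refl , []
uncovered {k = k} R R? (b ∷ is) {xs} (≤k ∷ ≤ks) long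
  with x , x∈ , ¬Rs ← uncovered R R? is {filter (¬? ∘ R? b) xs}
         (All.map (≤-trans (length-filter-filter _ (¬? ∘ R? b) xs)) ≤ks)
         (+-cancelˡ-< k _ _ (<-≤-trans long
           (≤-trans (≤-reflexive (sym (length-filter-¬ (R? b) xs))) (+-monoˡ-≤ _ ≤k))))
  with x∈xs , ¬Rb ← ∈-filter⁻ (¬? ∘ R? b) {xs = xs} x∈
  = x , x∈xs , ¬Rb ∷ ¬Rs

length-cover : ∀ {k} (R : V → U → Set) (R? : ∀ b → Decidable (R b)) (is : List V) {xs : List U} →
  (∀ {b} → b ∈ is → length (filter (R? b) xs) ≤ k) →
  (∀ {x} → x ∈ xs → ∃[ b ] b ∈ is × R b x) → length xs ≤ length is * k
length-cover R R? is ≤k cover = ≮⇒≥ λ long →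
  let x , x∈xs , ¬Rs = uncovered R R? is (All.tabulate ≤k) long
      b , b∈is , Rbx = cover x∈xs
  in All.lookup ¬Rs b∈is Rbx

-- Three distinct members are handed over as an injective function on `Fin 3`, the form in which the
-- 3 × 3 determinants index their rows.
length-≤2 : {xs : List U} → Unique xs →
  ((f : Fin 3 → U) → (∀ {i j} → f i ≡ f j → i ≡ j) → (∀ i → f i ∈ xs) → ⊥) → length xs ≤ 2
length-≤2 {xs = []}                  _ _ = z≤n
length-≤2 {xs = _ ∷ []}              _ _ = s≤s z≤n
length-≤2 {xs = _ ∷ _ ∷ []}          _ _ = s≤s (s≤s z≤n)
length-≤2 {U = U} {xs = x₀ ∷ x₁ ∷ x₂ ∷ xs} ((x₀≢x₁ ∷ x₀≢x₂ ∷ _) ∷ (x₁≢x₂ ∷ _) ∷ _) no-three =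
  contradiction f-∈ (no-three f f-injective)
  where
  f : Fin 3 → U
  f = List.lookup (x₀ ∷ x₁ ∷ x₂ ∷ [])

  f-∈ : ∀ i → f i ∈ x₀ ∷ x₁ ∷ x₂ ∷ xs
  f-∈ 0F = here refl
  f-∈ 1F = there (here refl)
  f-∈ 2F = there (there (here refl))

  f-injective : ∀ {i j} → f i ≡ f j → i ≡ j
  f-injective {0F} {0F} _ = refl
  f-injective {0F} {1F} p = contradiction p x₀≢x₁
  f-injective {0F} {2F} p = contradiction p x₀≢x₂
  f-injective {1F} {0F} p = contradiction (sym p) x₀≢x₁
  f-injective {1F} {1F} _ = refl
  f-injective {1F} {2F} p = contradiction p x₁≢x₂
  f-injective {2F} {0F} p = contradiction (sym p) x₀≢x₂
  f-injective {2F} {1F} p = contradiction (sym p) x₁≢x₂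
  f-injective {2F} {2F} _ = refl

unique-⊆⇒length-≤ : {xs ys : List U} → Unique xs → xs ⊆ ys → length xs ≤ length ys
unique-⊆⇒length-≤ [] _ = z≤n
unique-⊆⇒length-≤ {xs = x ∷ xs} (x∉xs ∷ uniq) xs⊆ys
  with as , bs , refl ← ∈-∃++ (xs⊆ys (here refl)) = begin
    suc (length xs)                  ≤⟨ s≤s (unique-⊆⇒length-≤ uniq xs⊆as++bs) ⟩
    suc (length (as ++ bs))          ≡⟨ cong suc (length-++ as) ⟩
    suc (length as + length bs)      ≡⟨ +-suc (length as) (length bs) ⟨
    length as + suc (length bs)      ≡⟨ length-++ as ⟨
    length (as ++ x ∷ bs)            ∎
  where
  open ≤-Reasoning
  xs⊆as++bs : xs ⊆ as ++ bs
  xs⊆as++bs y∈xs with ∈-++⁻ as (xs⊆ys (there y∈xs))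
  ... | inj₁ y∈as         = ∈-++⁺ˡ y∈as
  ... | inj₂ (here refl)  = contradiction refl (All.lookup x∉xs y∈xs)
  ... | inj₂ (there y∈bs) = ∈-++⁺ʳ as y∈bs

unique-map : {f : U → V} {xs : List U} →
  (∀ {x y} → x ∈ xs → y ∈ xs → f x ≡ f y → x ≡ y) → Unique xs → Unique (map f xs)
unique-map inj [] = []
unique-map inj (x∉xs ∷ uniq) =
  All.map⁺ (All.tabulate λ y∈xs fx≡fy →
    All.lookup x∉xs y∈xs (inj (here refl) (there y∈xs) fx≡fy))
  ∷ unique-map (λ p q → inj (there p) (there q)) uniq

length-cartesianProduct : (xs : List U) (ys : List V) →
  length (cartesianProduct xs ys) ≡ length xs * length ys
length-cartesianProduct []       ys = refl
length-cartesianProduct (x ∷ xs) ys = trans (length-++ (map (x ,_) ys))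
  (cong₂ _+_ (length-map (x ,_) ys) (length-cartesianProduct xs ys))

-- Plünnecke's inequality

-- Products of lists repeat values, so the size of the set that a list stands for is `card`, not
-- `length`.
card : List ℕ → ℕ
card xs = length (deduplicate _≟_ xs)

⊆-deduplicate : ∀ xs → xs ⊆ deduplicate _≟_ xs
⊆-deduplicate xs = ∈-deduplicate⁺ _≟_ {xs}

unique⇒length≤card : ∀ {xs ys} → Unique xs → xs ⊆ ys → length xs ≤ card ys
unique⇒length≤card {ys = ys} uniq xs⊆ys = unique-⊆⇒length-≤ uniq (⊆-deduplicate ys ∘ xs⊆ys)

card≤length : ∀ {xs ys} → xs ⊆ ys → card xs ≤ length ys
card≤length {xs} xs⊆ys =
  unique-⊆⇒length-≤ (deduplicate-! xs) (xs⊆ys ∘ ∈-deduplicate⁻ _≟_ xs)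

card-mono : ∀ {xs ys} → xs ⊆ ys → card xs ≤ card ys
card-mono {ys = ys} xs⊆ys = card≤length (⊆-deduplicate ys ∘ xs⊆ys)

infixl 7 _·_

_·_ : List ℕ → List ℕ → List ℕ
_·_ = cartesianProductWith _*_

·-monoʳ : ∀ xs {ys zs} → ys ⊆ zs → xs · ys ⊆ xs · zs
·-monoʳ xs {ys} ys⊆zs v∈ with _ , _ , x∈ , y∈ , refl ← ∈-cartesianProductWith⁻ _*_ xs ys v∈ =
  ∈-cartesianProductWith⁺ _*_ x∈ (ys⊆zs y∈)

·-monoˡ : ∀ {xs ys} zs → xs ⊆ ys → xs · zs ⊆ ys · zs
·-monoˡ {xs} zs xs⊆ys v∈ with _ , _ , x∈ , z∈ , refl ← ∈-cartesianProductWith⁻ _*_ xs zs v∈ =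
  ∈-cartesianProductWith⁺ _*_ (xs⊆ys x∈) z∈

·-assoc-⊆ : ∀ xs ys zs → xs · (ys · zs) ⊆ (xs · ys) · zs
·-assoc-⊆ xs ys zs v∈
  with x , _ , x∈ , yz∈ , refl ← ∈-cartesianProductWith⁻ _*_ xs (ys · zs) v∈
  with y , z , y∈ , z∈ , refl ← ∈-cartesianProductWith⁻ _*_ ys zs yz∈ =
  subst (_∈ (xs · ys) · zs) (*-assoc x y z)
    (∈-cartesianProductWith⁺ _*_ (∈-cartesianProductWith⁺ _*_ x∈ y∈) z∈)

-- Petridis' proof starts from a subset X minimising |X A| / |X|. Here a descent replaces the
-- minimisation: wherever minimality would be violated, such a `Z` is returned and the argument
-- restarts from it. The growth ratio p / q is kept as a cross-multiplied inequality.
record Shrinks (p q : ℕ) (A X Z : List ℕ) : Set where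
  field
    unique  : Unique Z
    ⊆X      : Z ⊆ X
    nonempty : 0 < length Z
    smaller : length Z < length X
    ratio   : q * card (Z · A) ≤ p * length Z

module _ (A X : List ℕ) (X-unique : Unique X) where

  module _ (c : ℕ) (c>0 : 0 < c) (C : List ℕ) where

    -- The exceptional set of Petridis' induction: elements through which adjoining `c` to `C` adds
    -- nothing to X A C.
    absorbed? : ∀ x → Dec (All (λ a → x * a * c ∈ X · A · C) A)
    absorbed? x = all? (λ a → x * a * c ∈? X · A · C) A

    absorbed : List ℕ
    absorbed = filter absorbed? X

    absorbed-⊆ : absorbed ⊆ X
    absorbed-⊆ = proj₁ ∘ ∈-filter⁻ absorbed? {xs = X}

    -- Among the products e c with e in X A, those with e in `absorbed · A` already lie in X A C, so
    -- at most |X A| - |absorbed A| are new. The additive form avoids subtraction.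
    card-XAC-≤ : card (X · A · (c ∷ C)) + card (absorbed · A) ≤ card (X · A · C) + card (X · A)
    card-XAC-≤ = begin
      card (X · A · (c ∷ C)) + card (absorbed · A)
        ≤⟨ +-mono-≤ (card≤length cover) (card≤length old-cover) ⟩
      length (deduplicate _≟_ (X · A · C) ++ map (_* c) new) + length old
        ≡⟨ cong (_+ length old) (trans (length-++ (deduplicate _≟_ (X · A · C)))
             (cong (card (X · A · C) +_) (length-map (_* c) new))) ⟩
      card (X · A · C) + length new + length old
        ≡⟨ trans (+-assoc (card (X · A · C)) _ _)
             (cong (card (X · A · C) +_) (+-comm (length new) _)) ⟩
      card (X · A · C) + (length old + length new)
        ≡⟨ cong (card (X · A · C) +_) (length-filter-¬ (_∈? absorbed · A) (deduplicate _≟_ (X · A))) ⟩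
      card (X · A · C) + card (X · A) ∎
      where
      open ≤-Reasoning
      old new : List ℕ
      old = filter (_∈? absorbed · A) (deduplicate _≟_ (X · A))
      new = filter (¬? ∘ (_∈? absorbed · A)) (deduplicate _≟_ (X · A))

      old-cover : absorbed · A ⊆ old
      old-cover v∈ = ∈-filter⁺ (_∈? absorbed · A) (⊆-deduplicate (X · A) (·-monoˡ A absorbed-⊆ v∈)) v∈

      cover : X · A · (c ∷ C) ⊆ deduplicate _≟_ (X · A · C) ++ map (_* c) new
      cover v∈ with ∈-cartesianProductWith⁻ _*_ (X · A) (c ∷ C) v∈
      ... | e , _ , e∈ , there c∈ , refl =
        ∈-++⁺ˡ (⊆-deduplicate (X · A · C) (∈-cartesianProductWith⁺ _*_ e∈ c∈))
      ... | e , _ , e∈ , here refl , refl with e ∈? absorbed · A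
      ...   | no  e∉ = ∈-++⁺ʳ _ (∈-map⁺ (_* c)
        (∈-filter⁺ (¬? ∘ (_∈? absorbed · A)) (⊆-deduplicate (X · A) e∈) e∉))
      ...   | yes e∈′ with x , a , x∈ , a∈ , refl ← ∈-cartesianProductWith⁻ _*_ absorbed A e∈′ =
        ∈-++⁺ˡ (⊆-deduplicate (X · A · C) (All.lookup (proj₂ (∈-filter⁻ absorbed? {xs = X} x∈)) a∈))

    -- If x c = x′ c′ with x′ in X and c′ in `C`, then x a c = x′ a c′ for every a, so x is
    -- absorbed. Hence each x that is not absorbed contributes a new element x c, and these are
    -- distinct because c > 0.
    card-XC-≥ : card (X · C) + length X ≤ card (X · (c ∷ C)) + length absorbed
    card-XC-≥ = begin
      card (X · C) + length X
        ≡⟨ cong (card (X · C) +_) (trans (sym (length-filter-¬ absorbed? X)) (+-comm (length absorbed) _)) ⟩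
      card (X · C) + (length new + length absorbed)
        ≡⟨ +-assoc (card (X · C)) _ _ ⟨
      card (X · C) + length new + length absorbed
        ≡⟨ cong (_+ length absorbed) (trans (length-++ (deduplicate _≟_ (X · C)))
             (cong (card (X · C) +_) (length-map (_* c) new))) ⟨
      length (deduplicate _≟_ (X · C) ++ map (_* c) new) + length absorbed
        ≤⟨ +-monoˡ-≤ _ (unique⇒length≤card
             (Unique.++⁺ (deduplicate-! (X · C))
               (Unique.map⁺ (*-cancelʳ-≡ _ _ c ⦃ >-nonZero c>0 ⦄)
                 (Unique.filter⁺ (¬? ∘ absorbed?) X-unique))
               disjoint)
             sub) ⟩
      card (X · (c ∷ C)) + length absorbed ∎
      where
      open ≤-Reasoning
      new : List ℕ
      new = filter (¬? ∘ absorbed?) X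

      disjoint : ∀ {v} → ¬ (v ∈ deduplicate _≟_ (X · C) × v ∈ map (_* c) new)
      disjoint (v∈ , v∈′)
        with x , x∈ , refl ← ∈-map⁻ (_* c) v∈′
        with x∈X , ¬abs ← ∈-filter⁻ (¬? ∘ absorbed?) {xs = X} x∈
        with x′ , c′ , x′∈ , c′∈ , eq ← ∈-cartesianProductWith⁻ _*_ X C (∈-deduplicate⁻ _≟_ (X · C) v∈)
        = ¬abs (All.tabulate λ {a} a∈ → subst (_∈ X · A · C) (sym (exchange {x} {x′} {c′} a eq))
            (∈-cartesianProductWith⁺ _*_ (∈-cartesianProductWith⁺ _*_ x′∈ a∈) c′∈))
        where
        exchange : ∀ {x x′ c′} a → x * c ≡ x′ * c′ → x * a * c ≡ x′ * a * c′
        exchange {x} {x′} {c′} a eq =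
          trans (xy∙z≈xz∙y x a c) (trans (cong (_* a) eq) (sym (xy∙z≈xz∙y x′ a c′)))

      sub : deduplicate _≟_ (X · C) ++ map (_* c) new ⊆ X · (c ∷ C)
      sub v∈ with ∈-++⁻ (deduplicate _≟_ (X · C)) v∈
      ... | inj₁ v∈ = ·-monoʳ X there (∈-deduplicate⁻ _≟_ (X · C) v∈)
      ... | inj₂ v∈ with x , x∈ , refl ← ∈-map⁻ (_* c) v∈ =
        ∈-cartesianProductWith⁺ _*_ (proj₁ (∈-filter⁻ (¬? ∘ absorbed?) {xs = X} x∈)) (here refl)

  -- Petridis' inequality |X A C| / |X C| ≤ p / q, or else a subset of X whose
  -- growth under A is also at most p / q.
  petridis : ∀ {p q} → q * card (X · A) ≤ p * length X → ∀ C → All (0 <_) C →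
    q * card (X · A · C) ≤ p * card (X · C) ⊎ ∃[ Z ] Shrinks p q A X Z
  petridis {p} {q} ratio [] [] = inj₁ (≤-trans (≤-reflexive
    (trans (cong (λ vs → q * card vs) (cartesianProductWith-zeroʳ _*_ (X · A))) (*-zeroʳ q))) z≤n)
  petridis {p} {q} ratio (c ∷ C) (c>0 ∷ C>0) with petridis {p} {q} ratio C C>0
  ... | inj₂ shrinks = inj₂ shrinks
  ... | inj₁ ih with q * card (Z · A) <? p * length Z
    where Z = absorbed c c>0 C
  -- `Z` grows strictly less than p / q, and strictness makes it nonempty. Either it is a proper
  -- part of X and the descent continues, or it is all of X and adjoining `c` leaves X A C no
  -- larger.
  ...   | yes sparse = [ (λ smaller → inj₂ (Z , record
            { unique = Unique.filter⁺ (absorbed? c c>0 C) X-unique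
            ; ⊆X = absorbed-⊆ c c>0 C
            ; nonempty = Z-nonempty
            ; smaller = smaller
            ; ratio = <⇒≤ sparse }))
          , (λ Z≡X → inj₁ (begin
              q * card (X · A · (c ∷ C))
                ≤⟨ *-monoʳ-≤ q (+-cancelʳ-≤ (card (X · A)) _ _ (subst
                   (λ Z → card (X · A · (c ∷ C)) + card (Z · A) ≤ card (X · A · C) + card (X · A))
                   Z≡X (card-XAC-≤ c c>0 C))) ⟩
              q * card (X · A · C)         ≤⟨ ih ⟩
              p * card (X · C)             ≤⟨ *-monoʳ-≤ p (card-mono (·-monoʳ X there)) ⟩
              p * card (X · (c ∷ C))       ∎)) ]′ size
    where
    open ≤-Reasoning
    Z = absorbed c c>0 C
    size : length Z < length X ⊎ Z ≡ X
    size with m≤n⇒m<n∨m≡n (unique-⊆⇒length-≤ (Unique.filter⁺ (absorbed? c c>0 C) X-unique) (absorbed-⊆ c c>0 C))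
    ... | inj₁ lt = inj₁ lt
    ... | inj₂ eq = inj₂ (filter-complete (absorbed? c c>0 C) eq)
    Z-nonempty : 0 < length Z
    Z-nonempty = n≢0⇒n>0 λ Z≡0 → n≮0 (<-≤-trans sparse (≤-reflexive (trans (cong (p *_) Z≡0) (*-zeroʳ p))))
  -- Now p |Z| ≤ q |Z A|, so the new elements of X A C, at most |X A| - |Z A| of them, are paid for
  -- by the at least |X| - |Z| new elements of X C.
  ...   | no dense = inj₁ (+-cancelʳ-≤ (p * length X + p * length Z) _ _ (begin
      q * card (X · A · (c ∷ C)) + (p * length X + p * length Z)
        ≤⟨ +-monoʳ-≤ (q * card (X · A · (c ∷ C))) (+-monoʳ-≤ (p * length X) (≮⇒≥ dense)) ⟩
      q * card (X · A · (c ∷ C)) + (p * length X + q * card (Z · A))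
        ≡⟨ solve 4 (λ q u v w → q :* u :+ (w :+ q :* v) := q :* (u :+ v) :+ w) refl
             q (card (X · A · (c ∷ C))) (card (Z · A)) (p * length X) ⟩
      q * (card (X · A · (c ∷ C)) + card (Z · A)) + p * length X
        ≤⟨ +-monoˡ-≤ (p * length X) (*-monoʳ-≤ q (card-XAC-≤ c c>0 C)) ⟩
      q * (card (X · A · C) + card (X · A)) + p * length X
        ≡⟨ cong (_+ p * length X) (*-distribˡ-+ q (card (X · A · C)) (card (X · A))) ⟩
      q * card (X · A · C) + q * card (X · A) + p * length X
        ≤⟨ +-monoˡ-≤ (p * length X) (+-mono-≤ ih ratio) ⟩
      p * card (X · C) + p * length X + p * length X
        ≡⟨ cong (_+ p * length X) (*-distribˡ-+ p (card (X · C)) (length X)) ⟨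
      p * (card (X · C) + length X) + p * length X
        ≤⟨ +-monoˡ-≤ (p * length X) (*-monoʳ-≤ p (card-XC-≥ c c>0 C)) ⟩
      p * (card (X · (c ∷ C)) + length Z) + p * length X
        ≡⟨ solve 4 (λ p u v w → p :* (u :+ v) :+ w := p :* u :+ (w :+ p :* v)) refl
             p (card (X · (c ∷ C))) (length Z) (p * length X) ⟩
      p * card (X · (c ∷ C)) + (p * length X + p * length Z) ∎))
    where
    open ≤-Reasoning
    open ℕ-Solver
    Z = absorbed c c>0 C

pow : List ℕ → ℕ → List ℕ
pow A zero    = 1 ∷ []
pow A (suc k) = A · pow A k

pow-positive : ∀ {A} → All (0 <_) A → ∀ k → All (0 <_) (pow A k)
pow-positive A>0 zero = z<s ∷ []
pow-positive {A} A>0 (suc k) = All.tabulate positive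
  where
  positive : ∀ {v} → v ∈ A · pow A k → 0 < v
  positive v∈ with _ , _ , a∈ , b∈ , refl ← ∈-cartesianProductWith⁻ _*_ A (pow A k) v∈ =
    *-mono-≤ (All.lookup A>0 a∈) (All.lookup (pow-positive A>0 k) b∈)

module _ {A : List ℕ} (A>0 : All (0 <_) A) {p q : ℕ} where

  -- Petridis' inequality with `C` equal to `pow A k` bounds each further factor of A by p / q,
  -- unless some step yields a smaller set.
  growth : ∀ {X} → Unique X → q * card (X · A) ≤ p * length X → ∀ k →
    q ^ k * card (X · pow A k) ≤ p ^ k * length X ⊎ ∃[ Z ] Shrinks p q A X Z
  growth {X} uniq ratio zero = inj₁ (*-monoʳ-≤ 1 (card≤length X·1⊆X))
    where
    X·1⊆X : X · (1 ∷ []) ⊆ X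
    X·1⊆X v∈ with x , _ , x∈ , here refl , refl ← ∈-cartesianProductWith⁻ _*_ X (1 ∷ []) v∈ =
      subst (_∈ X) (sym (*-identityʳ x)) x∈
  growth {X} uniq ratio (suc k)
    with growth uniq ratio k | petridis A X uniq {p} {q} ratio (pow A k) (pow-positive A>0 k)
  ... | inj₂ shrinks | _ = inj₂ shrinks
  ... | inj₁ _ | inj₂ shrinks = inj₂ shrinks
  ... | inj₁ ih | inj₁ step = inj₁ (begin
    q * q ^ k * card (X · (A · pow A k))     ≤⟨ *-monoʳ-≤ (q * q ^ k) (card-mono (·-assoc-⊆ X A (pow A k))) ⟩
    q * q ^ k * card (X · A · pow A k)
      ≡⟨ solve 3 (λ a b c → a :* b :* c := b :* (a :* c)) refl q (q ^ k) (card (X · A · pow A k)) ⟩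
    q ^ k * (q * card (X · A · pow A k))     ≤⟨ *-monoʳ-≤ (q ^ k) step ⟩
    q ^ k * (p * card (X · pow A k))
      ≡⟨ solve 3 (λ a b c → b :* (a :* c) := a :* (b :* c)) refl p (q ^ k) (card (X · pow A k)) ⟩
    p * (q ^ k * card (X · pow A k))         ≤⟨ *-monoʳ-≤ p ih ⟩
    p * (p ^ k * length X)                   ≡⟨ *-assoc p (p ^ k) (length X) ⟨
    p * p ^ k * length X                     ∎)
    where
    open ≤-Reasoning
    open ℕ-Solver

  -- Each failure of `growth` replaces X by a strictly shorter list with ratio still at most p / q;
  -- `fuel` bounds the length and makes the descent structural.
  slow-subset : ∀ fuel {X} → length X ≤ fuel → Unique X → X ⊆ A → 0 < length X →
    q * card (X · A) ≤ p * length X → ∀ k →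
    ∃[ Z ] Unique Z × Z ⊆ A × 0 < length Z × q ^ k * card (Z · pow A k) ≤ p ^ k * length Z
  slow-subset zero X≤0 _ _ X>0 = contradiction X≤0 (<⇒≱ X>0)
  slow-subset (suc fuel) {X} X≤ uniq X⊆A X>0 ratio k with growth uniq ratio k
  ... | inj₁ slow = X , uniq , X⊆A , X>0 , slow
  ... | inj₂ (Z , sh) = slow-subset fuel (s≤s⁻¹ (≤-trans (Shrinks.smaller sh) X≤)) (Shrinks.unique sh)
    (X⊆A ∘ Shrinks.⊆X sh) (Shrinks.nonempty sh) (Shrinks.ratio sh) k

-- The descent starts at X = A with p / q = |A A| / |A|. For any element z of the resulting Z,
-- multiplication by z embeds `L` into Z · `pow A k`.
pluennecke : ∀ {A} → Unique A → All (0 <_) A → 0 < length A → ∀ k {L} → Unique L → L ⊆ pow A k →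
  length A ^ k * length L ≤ card (A · A) ^ k * length A
pluennecke {A} uniq A>0 A≢[] k {L} L-unique L⊆
  with slow-subset A>0 {card (A · A)} {length A} (length A) ≤-refl uniq (λ x∈ → x∈) A≢[]
         (≤-reflexive (*-comm (length A) (card (A · A)))) k
... | z ∷ Z , Z-unique , Z⊆A , _ , slow = begin
  length A ^ k * length L                     ≡⟨ cong (length A ^ k *_) (length-map (z *_) L) ⟨
  length A ^ k * length (map (z *_) L)
    ≤⟨ *-monoʳ-≤ (length A ^ k) (unique⇒length≤card
         (Unique.map⁺ (*-cancelˡ-≡ _ _ z ⦃ >-nonZero (All.lookup A>0 (Z⊆A (here refl))) ⦄) L-unique)
         zL⊆) ⟩
  length A ^ k * card ((z ∷ Z) · pow A k)     ≤⟨ slow ⟩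
  card (A · A) ^ k * length (z ∷ Z)
    ≤⟨ *-monoʳ-≤ (card (A · A) ^ k) (unique-⊆⇒length-≤ Z-unique Z⊆A) ⟩
  card (A · A) ^ k * length A                 ∎
  where
  open ≤-Reasoning
  zL⊆ : map (z *_) L ⊆ (z ∷ Z) · pow A k
  zL⊆ v∈ with l , l∈ , refl ← ∈-map⁻ (z *_) v∈ = ∈-cartesianProductWith⁺ _*_ {xs = z ∷ Z} (here refl) (L⊆ l∈)

-- Classes modulo powers

IsPower : ℕ → ℕ → Set
IsPower m n = ∃[ t ] t ^ m ≡ n

^-distribʳ-* : ∀ m a b → (a * b) ^ m ≡ a ^ m * b ^ m
^-distribʳ-* zero    a b = refl
^-distribʳ-* (suc m) a b =
  trans (cong (a * b *_) (^-distribʳ-* m a b)) ([m*n]*[o*p]≡[m*o]*[n*p] a b (a ^ m) (b ^ m))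

coprime-∣^⇒∣1 : ∀ {a b} → Coprime a b → ∀ m → a ∣ b ^ m → a ∣ 1
coprime-∣^⇒∣1 cop zero    a∣1 = a∣1
coprime-∣^⇒∣1 cop (suc m) a∣  = coprime-∣^⇒∣1 cop m (coprime-divisor cop a∣)

-- Division by the gcd leaves coprime a′ and b′ with a′ dividing a power of b′. Hence a′ = 1, and a
-- is the gcd itself.
^-∣⇒∣ : ∀ m {a b} → 0 < a → a ^ suc m ∣ b ^ suc m → a ∣ b
^-∣⇒∣ m {a} {b} a>0 div = subst (_∣ b) (sym a≡g) (gcd[m,n]∣n a b)
  where
  instance
    a≢0 : NonZero a
    a≢0 = >-nonZero a>0
    g≢0 : NonZero (gcd a b)
    g≢0 = ≢-nonZero (gcd[m,n]≢0 a b (inj₁ (≢-nonZero⁻¹ a)))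
    g^≢0 : NonZero (gcd a b ^ suc m)
    g^≢0 = m^n≢0 (gcd a b) (suc m)

  g a′ b′ : ℕ
  g = gcd a b
  a′ = a / g
  b′ = b / g

  a≡ : a′ * g ≡ a
  a≡ = m/n*n≡m (gcd[m,n]∣m a b)

  b≡ : b′ * g ≡ b
  b≡ = m/n*n≡m (gcd[m,n]∣n a b)

  split : ∀ {c d} → d * g ≡ c → c ^ suc m ≡ d ^ suc m * g ^ suc m
  split {d = d} refl = ^-distribʳ-* (suc m) d g

  a′∣1 : a′ ∣ 1
  a′∣1 = coprime-∣^⇒∣1 (coprime-/gcd a b) (suc m) (∣-trans (m∣m*n (a′ ^ m))
    (*-cancelʳ-∣ (g ^ suc m) (subst₂ _∣_ (split {d = a′} a≡) (split {d = b′} b≡) div)))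

  a≡g : a ≡ g
  a≡g = trans (sym a≡) (trans (cong (_* g) (∣1⇒≡1 a′∣1)) (*-identityˡ g))

-- The exponent is positive, so a root is at most n and a bounded search decides.
isPower? : ∀ m n → Dec (IsPower (suc m) n)
isPower? m n = map′ (λ (t , _ , eq) → t , eq) (λ (t , eq) → t , s≤s (bound t eq) , eq)
  (anyUpTo? (λ t → t ^ suc m ≟ n) (suc n))
  where
  bound : ∀ t → t ^ suc m ≡ n → t ≤ n
  bound zero    _  = z≤n
  bound (suc t) eq = ≤-trans (m≤m*n (suc t) (suc t ^ m) ⦃ m^n≢0 (suc t) m ⦄) (≤-reflexive eq)

module _ (m : ℕ) where

  -- For positive ρ this says that x / ρ is the (1 + m)-th power of a rational.
  SameClass : ℕ → ℕ → Set
  SameClass ρ x = IsPower (suc m) (ρ ^ m * x)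

  sameClass? : ∀ ρ x → Dec (SameClass ρ x)
  sameClass? ρ x = isPower? m (ρ ^ m * x)

  sameClass-refl : ∀ x → SameClass x x
  sameClass-refl x = x , *-comm x (x ^ m)

  -- Multiplying the equation by `ρ′ ^ m` gives `ρ′ ^ m * ρ * s ^ suc m` = `(ρ′ * s′) ^ suc m`. Thus
  -- s divides ρ′ s′, and the quotient is the required root.
  ≡⇒sameClass : ∀ {ρ ρ′ s s′} → 0 < s → ρ * s ^ suc m ≡ ρ′ * s′ ^ suc m → SameClass ρ′ ρ
  ≡⇒sameClass {ρ} {ρ′} {s} {s′} s>0 eq = t , *-cancelʳ-≡ _ _ (s ^ suc m) (begin
    t ^ suc m * s ^ suc m          ≡⟨ ^-distribʳ-* (suc m) t s ⟨
    (t * s) ^ suc m                ≡⟨ cong (_^ suc m) (_∣_.equality s∣) ⟨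
    (ρ′ * s′) ^ suc m              ≡⟨ expand ⟨
    ρ′ ^ m * ρ * s ^ suc m         ∎)
    where
    open ≡-Reasoning
    instance
      s^≢0 : NonZero (s ^ suc m)
      s^≢0 = m^n≢0 s (suc m) ⦃ >-nonZero s>0 ⦄

    expand : ρ′ ^ m * ρ * s ^ suc m ≡ (ρ′ * s′) ^ suc m
    expand = begin
      ρ′ ^ m * ρ * s ^ suc m         ≡⟨ *-assoc (ρ′ ^ m) ρ _ ⟩
      ρ′ ^ m * (ρ * s ^ suc m)       ≡⟨ cong (ρ′ ^ m *_) eq ⟩
      ρ′ ^ m * (ρ′ * s′ ^ suc m)     ≡⟨ *-assoc (ρ′ ^ m) ρ′ _ ⟨
      ρ′ ^ m * ρ′ * s′ ^ suc m       ≡⟨ cong (_* s′ ^ suc m) (*-comm (ρ′ ^ m) ρ′) ⟩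
      ρ′ ^ suc m * s′ ^ suc m        ≡⟨ ^-distribʳ-* (suc m) ρ′ s′ ⟨
      (ρ′ * s′) ^ suc m              ∎

    s∣ : s ∣ ρ′ * s′
    s∣ = ^-∣⇒∣ m s>0 (divides (ρ′ ^ m * ρ) (sym expand))

    t : ℕ
    t = _∣_.quotient s∣

  reps : List ℕ → List ℕ
  reps []      = []
  reps (s ∷ S) with any? (λ ρ → sameClass? ρ s) (reps S)
  ... | yes _ = reps S
  ... | no  _ = s ∷ reps S

  reps-⊆ : ∀ S → reps S ⊆ S
  reps-⊆ (s ∷ S) ρ∈ with any? (λ ρ → sameClass? ρ s) (reps S) | ρ∈
  ... | yes _ | ρ∈         = there (reps-⊆ S ρ∈)
  ... | no  _ | here refl  = here refl
  ... | no  _ | there ρ∈   = there (reps-⊆ S ρ∈)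

  reps-cover : ∀ S → All (λ s → Any (λ ρ → SameClass ρ s) (reps S)) S
  reps-cover []      = []
  reps-cover (s ∷ S) with any? (λ ρ → sameClass? ρ s) (reps S)
  ... | yes s∼ = s∼ ∷ reps-cover S
  ... | no  _  = here (sameClass-refl s) ∷ All.map there (reps-cover S)

  reps-distinct : ∀ S → AllPairs (λ s ρ → ¬ SameClass ρ s) (reps S)
  reps-distinct []      = []
  reps-distinct (s ∷ S) with any? (λ ρ → sameClass? ρ s) (reps S)
  ... | yes _   = reps-distinct S
  ... | no  s≁  = All.¬Any⇒All¬ (reps S) s≁ ∷ reps-distinct S

  allPairs-lookup : ∀ {R : ℕ → ℕ → Set} {xs x y} → AllPairs R xs → x ∈ xs → y ∈ xs →
    x ≡ y ⊎ R x y ⊎ R y x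
  allPairs-lookup (_ ∷ _)   (here refl) (here refl) = inj₁ refl
  allPairs-lookup (rs ∷ _)  (here refl) (there y∈)  = inj₂ (inj₁ (All.lookup rs y∈))
  allPairs-lookup (rs ∷ _)  (there x∈)  (here refl) = inj₂ (inj₂ (All.lookup rs x∈))
  allPairs-lookup (_ ∷ rss) (there x∈)  (there y∈)  = allPairs-lookup rss x∈ y∈

  reps-unique : ∀ S → Unique (reps S)
  reps-unique S = AllPairs.map
    (λ {s} {ρ} ≁ s≡ρ → ≁ (subst (SameClass ρ) (sym s≡ρ) (sameClass-refl ρ))) (reps-distinct S)

  module _ {S : List ℕ} (S-unique : Unique S) (S>0 : All (0 <_) S) where

    ^∈pow : ∀ {s} → s ∈ S → ∀ k → s ^ k ∈ pow S k
    ^∈pow s∈ zero    = here refl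
    ^∈pow s∈ (suc k) = ∈-cartesianProductWith⁺ _*_ s∈ (^∈pow s∈ k)

    scale : ℕ × ℕ → ℕ
    scale (ρ , s) = ρ * s ^ suc m

    -- An equality of products puts ρ and ρ′ in one class, so they are equal, and then s and s′
    -- agree by monotonicity of powers. `reps-distinct` compares representatives in list order only,
    -- so the equation is read in whichever direction that order requires.
    scale-injective : ∀ {u v} → u ∈ cartesianProduct (reps S) S → v ∈ cartesianProduct (reps S) S →
      scale u ≡ scale v → u ≡ v
    scale-injective {ρ , s} {ρ′ , s′} u∈ v∈ eq
      with ρ∈ , s∈ ← ∈-cartesianProduct⁻ (reps S) S u∈
      with ρ′∈ , s′∈ ← ∈-cartesianProduct⁻ (reps S) S v∈
      with allPairs-lookup (reps-distinct S) ρ∈ ρ′∈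
    ... | inj₂ (inj₁ ≁) = contradiction (≡⇒sameClass {s = s} {s′} (All.lookup S>0 s∈) eq) ≁
    ... | inj₂ (inj₂ ≁) = contradiction (≡⇒sameClass {s = s′} {s} (All.lookup S>0 s′∈) (sym eq)) ≁
    ... | inj₁ refl = cong (ρ ,_)
      (^-injective (*-cancelˡ-≡ _ _ ρ ⦃ >-nonZero (All.lookup S>0 (reps-⊆ S ρ∈)) ⦄ eq))
      where
      ^-injective : s ^ suc m ≡ s′ ^ suc m → s ≡ s′
      ^-injective eq with <-cmp s s′
      ... | tri≈ _ s≡s′ _ = s≡s′
      ... | tri< s<s′ _ _ = contradiction eq (<⇒≢ (^-monoˡ-< (suc m) s<s′))
      ... | tri> _ _ s′<s = contradiction (sym eq) (<⇒≢ (^-monoˡ-< (suc m) s′<s))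

    -- With n = |S| and r representatives, the r n distinct values of `scale` are products of m + 2
    -- elements of S. Plünnecke's inequality bounds their number, and one factor n cancels.
    reps-bound : 0 < length S →
      length S ^ suc (suc m) * length (reps S) ≤ card (S · S) ^ suc (suc m)
    reps-bound S≢[] = *-cancelʳ-≤ _ _ (length S) ⦃ >-nonZero S≢[] ⦄ (begin
      length S ^ suc (suc m) * length (reps S) * length S    ≡⟨ *-assoc (length S ^ suc (suc m)) _ _ ⟩
      length S ^ suc (suc m) * (length (reps S) * length S)
        ≡⟨ cong (length S ^ suc (suc m) *_) (trans
             (length-map scale (cartesianProduct (reps S) S)) (length-cartesianProduct (reps S) S)) ⟨
      length S ^ suc (suc m) * length (map scale (cartesianProduct (reps S) S))
        ≤⟨ pluennecke S-unique S>0 S≢[] (suc (suc m))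
             (unique-map scale-injective (Unique.cartesianProduct⁺ (reps-unique S) S-unique)) scale⊆ ⟩
      card (S · S) ^ suc (suc m) * length S ∎)
      where
      open ≤-Reasoning
      scale⊆ : map scale (cartesianProduct (reps S) S) ⊆ pow S (suc (suc m))
      scale⊆ v∈ with _ , u∈ , refl ← ∈-map⁻ scale v∈
        with ρ∈ , s∈ ← ∈-cartesianProduct⁻ (reps S) S u∈
        = ∈-cartesianProductWith⁺ _*_ (reps-⊆ S ρ∈) (^∈pow s∈ (suc m))

-- Numerical estimates

-- Here b and g count the bad and good pairs, t the sums, and k stands for r³. At most half of the
-- n² pairs are bad, so n² / 2 ≤ g ≤ 2 t.
square-≤ : ∀ {n b g k t} → n * n ≡ b + g → b ≤ n * (k * 18) → g ≤ t * 2 → 36 * k ≤ n →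
  n * n ≤ 4 * t
square-≤ {n} {b} {g} {k} {t} split b≤ g≤ few = +-cancelˡ-≤ (n * n) _ _ (begin
  n * n + n * n                                ≡⟨ cong₂ _+_ split split ⟩
  b + g + (b + g)                              ≤⟨ +-mono-≤ (+-mono-≤ b≤ g≤) (+-mono-≤ b≤ g≤) ⟩
  n * (k * 18) + t * 2 + (n * (k * 18) + t * 2)
    ≡⟨ solve 3 (λ n k t →
         n :* (k :* con 18) :+ t :* con 2 :+ (n :* (k :* con 18) :+ t :* con 2) :=
         n :* (con 36 :* k) :+ con 4 :* t) refl n k t ⟩
  n * (36 * k) + 4 * t                         ≤⟨ +-monoˡ-≤ _ (*-monoʳ-≤ n few) ⟩
  n * n + 4 * t                                ∎)
  where
  open ≤-Reasoning
  open ℕ-Solver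

-- For r ≤ 36 the left side is at most 36⁴; for r ≥ 36 it is at most r⁴. This fixes the threshold
-- 36⁴ for n.
few-classes : ∀ {r n} → 36 ^ 4 ≤ n → r ^ 4 < n → 36 * (r * (r * r)) ≤ n
few-classes {r} {n} n₀≤n r⁴<n with ≤-total r 36
... | inj₁ r≤36 = ≤-trans (*-monoʳ-≤ 36 (*-mono-≤ r≤36 (*-mono-≤ r≤36 r≤36))) n₀≤n
... | inj₂ 36≤r = ≤-trans (*-monoˡ-≤ (r * (r * r)) 36≤r) (<⇒≤ (subst (_< n)
  (solve 1 (λ r → r :^ 4 := r :* (r :* (r :* r))) refl r) r⁴<n))
  where open ℕ-Solver

-- The fourth power of `bound` reads n^(4k) r⁴ ≤ P^(4k), and `small` is the growth hypothesis for c
-- = 1 / (4k).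
fourth-power-< : ∀ {n r P} k → n ^ k * r ≤ P ^ k → P ^ (4 * k) < n ^ (4 * k + 1) → r ^ 4 < n
fourth-power-< {n} {r} {P} k bound small = *-cancelˡ-< (n ^ (4 * k)) _ _ (begin-strict
  n ^ (4 * k) * r ^ 4      ≡⟨ cong (λ e → n ^ e * r ^ 4) (*-comm 4 k) ⟩
  n ^ (k * 4) * r ^ 4      ≡⟨ cong (_* r ^ 4) (^-*-assoc n k 4) ⟨
  (n ^ k) ^ 4 * r ^ 4      ≡⟨ ^-distribʳ-* 4 (n ^ k) r ⟨
  (n ^ k * r) ^ 4          ≤⟨ ^-monoˡ-≤ 4 bound ⟩
  (P ^ k) ^ 4              ≡⟨ trans (^-*-assoc P k 4) (cong (P ^_) (*-comm k 4)) ⟩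
  P ^ (4 * k)              <⟨ small ⟩
  n ^ (4 * k + 1)          ≡⟨ trans (^-distribˡ-+-* n (4 * k) 1) (cong (n ^ (4 * k) *_) (^-identityʳ n)) ⟩
  n ^ (4 * k) * n          ∎)
  where open ≤-Reasoning

-- Signed determinants

open import Data.Integer using (+_)
open ℤ-Solver

*-pos : ∀ {m n} → 0 < m → 0 < n → 0 < m * n
*-pos p q = *-mono-≤ p q

root-pos : ∀ {m t n} → 0 < n → t ^ suc m ≡ n → 0 < t
root-pos {t = suc _} _ _ = z<s
root-pos {t = zero} () refl

-- The conjecture at one exponent.
Rigid : ℕ → Set
Rigid m = (ε : Fin 24 → Sign) (x : Fin 24 → ℕ) → (∀ i → 0 < x i) →
  signedPowerSum m ε x ≡ 0ℤ → Trivial ε x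

◃-split : ∀ s n → s ◃ n ≡ (s ◃ 1) ℤ.* + n
◃-split Sign.+ n = trans (ℤ.+◃n≡+n n) (sym (ℤ.*-identityˡ (+ n)))
◃-split Sign.- n = trans (ℤ.-◃n≡-n n) (sym (ℤ.-1*i≡-i (+ n)))

-- A vanishing signed sum of the P j becomes a vanishing signed sum of m-th
-- powers after multiplication by a common factor D.
rigid⇒matched : ∀ {m} → Rigid (suc m) →
  (ε : Fin 24 → Sign) (P : Fin 24 → ℕ) {D : ℕ} → 0 < D → (∀ j → 0 < P j) →
  (∀ j → IsPower (suc m) (D * P j)) →
  ∑[ j < 24 ] ((ε j ◃ 1) ℤ.* + P j) ≡ 0ℤ →
  ∀ i → ∃[ j ] ε j ≡ opposite (ε i) × P i ≡ P j
rigid⇒matched {m} rigid ε P {D} D>0 P>0 power Σ≡0 i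
  = j , trans (proj₂ (same j)) (cong (opposite ∘ ε) (partner-involutive π i))
  , *-cancelˡ-≡ _ _ D ⦃ >-nonZero D>0 ⦄
      (trans (sym (proj₂ (power i)))
        (trans (cong (_^ suc m) (proj₁ (same i))) (proj₂ (power j))))
  where
  root : Fin 24 → ℕ
  root j = proj₁ (power j)

  term : ∀ j → ε j ◃ root j ^ suc m ≡ + D ℤ.* ((ε j ◃ 1) ℤ.* + P j)
  term j = begin
    ε j ◃ root j ^ suc m              ≡⟨ cong (ε j ◃_) (proj₂ (power j)) ⟩
    ε j ◃ D * P j                     ≡⟨ ◃-split (ε j) (D * P j) ⟩
    (ε j ◃ 1) ℤ.* + (D * P j)         ≡⟨ cong ((ε j ◃ 1) ℤ.*_) (ℤ.pos-* D (P j)) ⟩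
    (ε j ◃ 1) ℤ.* (+ D ℤ.* + P j)
      ≡⟨ solve 3 (λ e d p → e :* (d :* p) := d :* (e :* p)) refl (ε j ◃ 1) (+ D) (+ P j) ⟩
    + D ℤ.* ((ε j ◃ 1) ℤ.* + P j)     ∎
    where open ≡-Reasoning

  Σroot : signedPowerSum (suc m) ε root ≡ 0ℤ
  Σroot = begin
    signedPowerSum (suc m) ε root                      ≡⟨ sum-cong-≗ term ⟩
    ∑[ j < 24 ] (+ D ℤ.* ((ε j ◃ 1) ℤ.* + P j))        ≡⟨ *-distribˡ-sum (+ D) (λ j → (ε j ◃ 1) ℤ.* + P j) ⟨
    + D ℤ.* ∑[ j < 24 ] ((ε j ◃ 1) ℤ.* + P j)          ≡⟨ cong (+ D ℤ.*_) Σ≡0 ⟩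
    + D ℤ.* 0ℤ                                         ≡⟨ ℤ.*-zeroʳ (+ D) ⟩
    0ℤ                                                 ∎
    where open ≡-Reasoning

  trivial : Trivial ε root
  trivial = rigid ε root (λ j → root-pos {m} (*-pos D>0 (P>0 j)) (proj₂ (power j))) Σroot

  π : Pairing 24
  π = proj₁ trivial

  same : ∀ i → root i ≡ root (partner π i) × ε i ≡ opposite (ε (partner π i))
  same = proj₂ trivial

  j : Fin 24
  j = partner π i

power-* : ∀ {m a b} → IsPower m a → IsPower m b → IsPower m (a * b)
power-* {m} (s , refl) (t , refl) = s * t , ^-distribʳ-* m s t

-- The six terms of the determinant with rows (1 , v i , w i), 0F being the diagonal one.
leibniz₃ : Fin 6 → Sign × Fin 3 × Fin 3
leibniz₃ = lookup
  ( (Sign.+ , 1F , 2F) ∷ (Sign.- , 2F , 1F)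
  ∷ (Sign.- , 0F , 2F) ∷ (Sign.+ , 2F , 0F)
  ∷ (Sign.+ , 0F , 1F) ∷ (Sign.- , 1F , 0F) ∷ [])

-- Each term is repeated four times to reach the length 24 of the conjecture.
τ : Fin 24 → Sign × Fin 3 × Fin 3
τ = leibniz₃ ∘ remainder {4} 6

τ-sign : Fin 24 → Sign
τ-sign j = proj₁ (τ j)

τ-term : {A : Set} → (A → A → A) → (v w : Fin 3 → A) → Fin 24 → A
τ-term _·_ v w j = let (_ , p , q) = τ j in v p · w q

-- The last column is a combination of the column of ones and the column `v`. The solver checks the
-- expansion, with the sum written as the fold to which it unfolds.
det₃-zero : (κ β : ℤ) (v : Fin 3 → ℤ) →
  ∑[ j < 24 ] ((τ-sign j ◃ 1) ℤ.* τ-term ℤ._*_ v (λ i → κ ℤ.- β ℤ.* v i) j) ≡ 0ℤ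
det₃-zero κ β v = solve 5 (λ κ β v₀ v₁ v₂ →
    let v = lookup (v₀ ∷ v₁ ∷ v₂ ∷ []) in
    Vector.foldr _:+_ (con 0ℤ) (λ j → con (τ-sign j ◃ 1) :* τ-term _:*_ v (λ i → κ :- β :* v i) j)
      := con 0ℤ)
  refl κ β (v 0F) (v 1F) (v 2F)

-- The twelve even terms of the determinant with rows (1 , x i , y i , z i),
-- 0F being the diagonal one; exchanging the last two rows gives the odd terms.
even : Fin 12 → Fin 4 × Fin 4 × Fin 4
even = lookup
  ( (1F , 2F , 3F) ∷ (2F , 3F , 1F) ∷ (3F , 1F , 2F)
  ∷ (0F , 3F , 2F) ∷ (2F , 0F , 3F) ∷ (3F , 2F , 0F)
  ∷ (0F , 1F , 3F) ∷ (1F , 3F , 0F) ∷ (3F , 0F , 1F)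
  ∷ (0F , 2F , 1F) ∷ (1F , 0F , 2F) ∷ (2F , 1F , 0F) ∷ [])

leibniz₄ : Fin 2 × Fin 12 → Sign × Fin 4 × Fin 4 × Fin 4
leibniz₄ (0F , k) = Sign.+ , even k
leibniz₄ (1F , k) = let (p , q , r) = even k in Sign.- , p , r , q

σ : Fin 24 → Sign × Fin 4 × Fin 4 × Fin 4
σ = leibniz₄ ∘ remQuot {2} 12

σ-sign : Fin 24 → Sign
σ-sign j = proj₁ (σ j)

σ-term : {A : Set} → (A → A → A) → (x y z : Fin 4 → A) → Fin 24 → A
σ-term _·_ x y z j = let (_ , p , q , r) = σ j in (x p · y q) · z r

-- The column of x is the sum of those of y and z minus a times the column of ones.
det₄-zero : (a : ℤ) (y z : Fin 4 → ℤ) →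
  ∑[ j < 24 ] ((σ-sign j ◃ 1) ℤ.* σ-term ℤ._*_ (λ i → y i ℤ.+ (z i ℤ.- a)) y z j) ≡ 0ℤ
det₄-zero a y z = solve 9 (λ a y₀ y₁ y₂ y₃ z₀ z₁ z₂ z₃ →
    let y = lookup (y₀ ∷ y₁ ∷ y₂ ∷ y₃ ∷ [])
        z = lookup (z₀ ∷ z₁ ∷ z₂ ∷ z₃ ∷ []) in
    Vector.foldr _:+_ (con 0ℤ) (λ j → con (σ-sign j ◃ 1) :* σ-term _:*_ (λ i → y i :+ (z i :- a)) y z j)
      := con 0ℤ)
  refl a (y 0F) (y 1F) (y 2F) (y 3F) (z 0F) (z 1F) (z 2F) (z 3F)

-- Every term has one factor from each of the columns x, y and z, so the common multiplier
-- `cx * cy * cz` makes all of them powers. The diagonal term, at index `0F`, is positive, so its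
-- partner is odd.
det₄-matched : ∀ {m} → Rigid (suc m) → ∀ {a cx cy cz} → 0 < cx → 0 < cy → 0 < cz →
  (x y z : Fin 4 → ℕ) → (∀ i → 0 < x i) → (∀ i → 0 < y i) → (∀ i → 0 < z i) →
  (∀ i → IsPower (suc m) (cx * x i)) → (∀ i → IsPower (suc m) (cy * y i)) →
  (∀ i → IsPower (suc m) (cz * z i)) → (∀ i → a + x i ≡ y i + z i) →
  ∃[ j ] σ-sign j ≡ Sign.- × x 1F * y 2F * z 3F ≡ σ-term _*_ x y z j
det₄-matched {m} rigid {a} {cx} {cy} {cz} cx>0 cy>0 cz>0 x y z x>0 y>0 z>0 px py pz rel =
  rigid⇒matched {m} rigid σ-sign (σ-term _*_ x y z) {cx * cy * cz} (*-pos (*-pos cx>0 cy>0) cz>0)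
    (λ j → *-pos (*-pos (x>0 _) (y>0 _)) (z>0 _))
    (λ j → subst (IsPower (suc m)) (regroup _ _ _)
      (power-* {suc m} (power-* {suc m} (px _) (py _)) (pz _)))
    (trans (sum-cong-≗ term) (det₄-zero (+ a) (+_ ∘ y) (+_ ∘ z)))
    0F
  where
  regroup : ∀ p q r → cx * p * (cy * q) * (cz * r) ≡ cx * cy * cz * (p * q * r)
  regroup p q r = trans (cong (_* (cz * r)) ([m*n]*[o*p]≡[m*o]*[n*p] cx p cy q))
    ([m*n]*[o*p]≡[m*o]*[n*p] (cx * cy) (p * q) cz r)

  +x≡ : ∀ i → + x i ≡ + y i ℤ.+ (+ z i ℤ.- + a)
  +x≡ i = begin
    + x i                               ≡⟨ solve 2 (λ a x → x := (a :+ x) :- a) refl (+ a) (+ x i) ⟩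
    (+ a ℤ.+ + x i) ℤ.- + a
      ≡⟨ cong (ℤ._- + a) (trans (sym (ℤ.pos-+ a (x i))) (trans (cong +_ (rel i)) (ℤ.pos-+ (y i) (z i)))) ⟩
    (+ y i ℤ.+ + z i) ℤ.- + a           ≡⟨ ℤ.+-assoc (+ y i) (+ z i) (ℤ.- + a) ⟩
    + y i ℤ.+ (+ z i ℤ.- + a)           ∎
    where open ≡-Reasoning

  term : ∀ j → (σ-sign j ◃ 1) ℤ.* + σ-term _*_ x y z j ≡
    (σ-sign j ◃ 1) ℤ.* σ-term ℤ._*_ (λ i → + y i ℤ.+ (+ z i ℤ.- + a)) (+_ ∘ y) (+_ ∘ z) j
  term j = cong ((σ-sign j ◃ 1) ℤ.*_)
    (trans (ℤ.pos-* (x _ * y _) (z _))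
      (trans (cong (ℤ._* + z _) (ℤ.pos-* (x _) (y _)))
        (cong (λ u → u ℤ.* + y _ ℤ.* + z _) (+x≡ _))))

-- Scaling the last column by γ turns each w i into κ - β v i, which gives a vanishing determinant;
-- γ ≠ 0 then cancels.
det₃-matched : ∀ {m} → Rigid (suc m) → ∀ {cv cw} → 0 < cv → 0 < cw →
  ∀ {β γ κ} → γ ≢ 0ℤ →
  (v w : Fin 3 → ℕ) → (∀ i → 0 < v i) → (∀ i → 0 < w i) →
  (∀ i → IsPower (suc m) (cv * v i)) → (∀ i → IsPower (suc m) (cw * w i)) →
  (∀ i → β ℤ.* + v i ℤ.+ γ ℤ.* + w i ≡ κ) →
  ∃[ j ] τ-sign j ≡ Sign.- × v 1F * w 2F ≡ τ-term _*_ v w j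
det₃-matched {m} rigid {cv} {cw} cv>0 cw>0 {β} {γ} {κ} γ≢0 v w v>0 w>0 pv pw rel =
  rigid⇒matched {m} rigid τ-sign (τ-term _*_ v w) {cv * cw} (*-pos cv>0 cw>0)
    (λ j → *-pos (v>0 _) (w>0 _))
    (λ j → subst (IsPower (suc m)) ([m*n]*[o*p]≡[m*o]*[n*p] cv _ cw _) (power-* {suc m} (pv _) (pw _)))
    (ℤ.*-cancelˡ-≡ γ _ 0ℤ ⦃ ℤ.≢-nonZero γ≢0 ⦄ γΣ≡0)
    0F
  where
  γw≡ : ∀ i → γ ℤ.* + w i ≡ κ ℤ.- β ℤ.* + v i
  γw≡ i = trans (solve 2 (λ p q → q := (p :+ q) :- p) refl (β ℤ.* + v i) (γ ℤ.* + w i))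
    (cong (ℤ._- β ℤ.* + v i) (rel i))

  term : ∀ j → γ ℤ.* ((τ-sign j ◃ 1) ℤ.* + τ-term _*_ v w j) ≡
    (τ-sign j ◃ 1) ℤ.* τ-term ℤ._*_ (+_ ∘ v) (λ i → κ ℤ.- β ℤ.* + v i) j
  term j = begin
    γ ℤ.* (e ℤ.* + (v _ * w _))      ≡⟨ cong (λ u → γ ℤ.* (e ℤ.* u)) (ℤ.pos-* (v _) (w _)) ⟩
    γ ℤ.* (e ℤ.* (+ v _ ℤ.* + w _))
      ≡⟨ solve 4 (λ g e p q → g :* (e :* (p :* q)) := e :* (p :* (g :* q))) refl γ e (+ v _) (+ w _) ⟩
    e ℤ.* (+ v _ ℤ.* (γ ℤ.* + w _))  ≡⟨ cong (λ u → e ℤ.* (+ v _ ℤ.* u)) (γw≡ _) ⟩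
    e ℤ.* (+ v _ ℤ.* (κ ℤ.- β ℤ.* + v _)) ∎
    where
    open ≡-Reasoning
    e = τ-sign j ◃ 1

  γΣ≡0 : γ ℤ.* ∑[ j < 24 ] ((τ-sign j ◃ 1) ℤ.* + τ-term _*_ v w j) ≡ γ ℤ.* 0ℤ
  γΣ≡0 = trans (*-distribˡ-sum γ (λ j → (τ-sign j ◃ 1) ℤ.* + τ-term _*_ v w j))
    (trans (sum-cong-≗ term) (trans (det₃-zero κ β (+_ ∘ v)) (sym (ℤ.*-zeroʳ γ))))

-- The points (v i , w i) lie on a line that is parallel to neither axis and misses the origin, so
-- distinct points differ in v, in w and in v / w. Each of the three odd terms equal to the diagonal
-- one would force such a coincidence.
no-three-solutions : ∀ {m} → Rigid (suc m) → ∀ {cv cw} → 0 < cv → 0 < cw →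
  ∀ {β γ κ} → β ≢ 0ℤ → γ ≢ 0ℤ → κ ≢ 0ℤ →
  (v w : Fin 3 → ℕ) → (∀ i → 0 < v i) → (∀ i → 0 < w i) →
  (∀ i → IsPower (suc m) (cv * v i)) → (∀ i → IsPower (suc m) (cw * w i)) →
  (∀ i → β ℤ.* + v i ℤ.+ γ ℤ.* + w i ≡ κ) →
  (∀ {i j} → v i ≡ v j → w i ≡ w j → i ≡ j) → ⊥
no-three-solutions {m} rigid cv>0 cw>0 {β} {γ} {κ} β≢0 γ≢0 κ≢0 v w v>0 w>0 pv pw rel inj =
  let j , odd , eq = det₃-matched {m} rigid cv>0 cw>0 {β} γ≢0 v w v>0 w>0 pv pw rel
  in cases (remainder {4} 6 j) odd eq
  where
  v-injective : ∀ {i j} → v i ≡ v j → i ≡ j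
  v-injective {i} {j} p = inj p (ℤ.+-injective (ℤ.*-cancelˡ-≡ γ _ _ ⦃ ℤ.≢-nonZero γ≢0 ⦄
    (∙-cancelˡ (β ℤ.* + v i) _ _ (trans (rel i)
      (trans (sym (rel j)) (cong (λ u → β ℤ.* + u ℤ.+ γ ℤ.* + w j) (sym p)))))))

  w-injective : ∀ {i j} → w i ≡ w j → i ≡ j
  w-injective {i} {j} p = inj (ℤ.+-injective (ℤ.*-cancelˡ-≡ β _ _ ⦃ ℤ.≢-nonZero β≢0 ⦄
    (∙-cancelʳ (γ ℤ.* + w i) _ _ (trans (rel i)
      (trans (sym (rel j)) (cong (λ u → β ℤ.* + v j ℤ.+ γ ℤ.* + u) (sym p))))))) p

  -- If v i / w i = v j / w j then v i κ = v i (β v j + γ w j) = v j (β v i + γ w i) = v j κ.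
  ratio-injective : ∀ {i j} → v i * w j ≡ v j * w i → i ≡ j
  ratio-injective {i} {j} p = v-injective (ℤ.+-injective (ℤ.*-cancelʳ-≡ _ _ κ ⦃ ℤ.≢-nonZero κ≢0 ⦄ (begin
    + v i ℤ.* κ                                        ≡⟨ cong (+ v i ℤ.*_) (rel j) ⟨
    + v i ℤ.* (β ℤ.* + v j ℤ.+ γ ℤ.* + w j)
      ≡⟨ solve 5 (λ β γ p q r → p :* (β :* q :+ γ :* r) := β :* p :* q :+ γ :* (p :* r)) refl β γ (+ v i) (+ v j) (+ w j) ⟩
    β ℤ.* + v i ℤ.* + v j ℤ.+ γ ℤ.* (+ v i ℤ.* + w j)  ≡⟨ cong (λ u → β ℤ.* + v i ℤ.* + v j ℤ.+ γ ℤ.* u)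
                                                           (trans (sym (ℤ.pos-* (v i) (w j))) (trans (cong +_ p) (ℤ.pos-* (v j) (w i)))) ⟩
    β ℤ.* + v i ℤ.* + v j ℤ.+ γ ℤ.* (+ v j ℤ.* + w i)
      ≡⟨ solve 5 (λ β γ p q r → β :* p :* q :+ γ :* (q :* r) := q :* (β :* p :+ γ :* r)) refl β γ (+ v i) (+ v j) (+ w i) ⟩
    + v j ℤ.* (β ℤ.* + v i ℤ.+ γ ℤ.* + w i)            ≡⟨ cong (+ v j ℤ.*_) (rel i) ⟩
    + v j ℤ.* κ                                        ∎)))
    where open ≡-Reasoning

  cases : (k : Fin 6) → let (s , p , q) = leibniz₃ k in s ≡ Sign.- → v 1F * w 2F ≡ v p * w q → ⊥
  cases 1F _ eq = contradiction (ratio-injective {1F} {2F} eq) λ ()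
  cases 2F _ eq = contradiction (v-injective (*-cancelʳ-≡ _ _ (w 2F) ⦃ >-nonZero (w>0 2F) ⦄ eq)) λ ()
  cases 5F _ eq = contradiction (w-injective (*-cancelˡ-≡ _ _ (v 1F) ⦃ >-nonZero (v>0 1F) ⦄ eq)) λ ()

-- Solutions of a + x ≡ y + z

Row : Set
Row = ℕ × ℕ × ℕ

-- The multipliers `cx`, `cy`, `cz` encode the classes of x, y, z. By the equation, a ≠ y also gives
-- x ≠ z, and a ≠ z gives x ≠ y.
record IsSolution (m a cx cy cz : ℕ) (r : Row) : Set where
  private
    x = proj₁ r
    y = proj₁ (proj₂ r)
    z = proj₂ (proj₂ r)
  field
    x>0     : 0 < x
    y>0     : 0 < y
    z>0     : 0 < z
    power-x : IsPower m (cx * x)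
    power-y : IsPower m (cy * y)
    power-z : IsPower m (cz * z)
    a+x≡y+z : a + x ≡ y + z
    a≢y     : a ≢ y
    a≢z     : a ≢ z

-- The six functions x, y, z, x / y, x / z, y / z, with numerator `lhs` and denominator `rhs`.
-- `OnFibre` is the level set at d / e without division, so that one greedy argument can treat all
-- six uniformly.
data Fibre : Set where
  x-fibre y-fibre z-fibre xy-fibre xz-fibre yz-fibre : Fibre

lhs rhs : Fibre → Row → ℕ
lhs x-fibre  (x , _ , _) = x
lhs y-fibre  (_ , y , _) = y
lhs z-fibre  (_ , _ , z) = z
lhs xy-fibre (x , _ , _) = x
lhs xz-fibre (x , _ , _) = x
lhs yz-fibre (_ , y , _) = y
rhs x-fibre  _ = 1
rhs y-fibre  _ = 1
rhs z-fibre  _ = 1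
rhs xy-fibre (_ , y , _) = y
rhs xz-fibre (_ , _ , z) = z
rhs yz-fibre (_ , _ , z) = z

OnFibre : Fibre × ℕ × ℕ → Row → Set
OnFibre (k , e , d) r = e * lhs k r ≡ d * rhs k r

onFibre? : ∀ b r → Dec (OnFibre b r)
onFibre? (k , e , d) r = e * lhs k r ≟ d * rhs k r

pos≢0 : ∀ {n} → 0 < n → + n ≢ 0ℤ
pos≢0 {suc _} _ ()

module _ {m} (rigid : Rigid (suc m)) {a cx cy cz : ℕ}
  (a>0 : 0 < a) (cx>0 : 0 < cx) (cy>0 : 0 < cy) (cz>0 : 0 < cz) where

  Solution : Row → Set
  Solution = IsSolution (suc m) a cx cy cz

  module _ {e : ℕ} (d : ℕ) (e>0 : 0 < e) (f : Fin 3 → Row)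
    (f-injective : ∀ {i j} → f i ≡ f j → i ≡ j) (sol : ∀ i → Solution (f i)) where

    private
      module Sol i = IsSolution (sol i)
      open Sol

      x y z : Fin 3 → ℕ
      x i = proj₁ (f i)
      y i = proj₁ (proj₂ (f i))
      z i = proj₂ (proj₂ (f i))

      A : ℤ
      A = + a

      E D : ℤ
      E = + e
      D = + d

      X Y Z : Fin 3 → ℤ
      X = +_ ∘ x
      Y = +_ ∘ y
      Z = +_ ∘ z

      relation : ∀ i → A ℤ.+ X i ≡ Y i ℤ.+ Z i
      relation i = trans (sym (ℤ.pos-+ a (x i))) (trans (cong +_ (a+x≡y+z i)) (ℤ.pos-+ (y i) (z i)))

      +-eq : ∀ {p q p′ q′} → p * q ≡ p′ * q′ → + p ℤ.* + q ≡ + p′ ℤ.* + q′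
      +-eq {p} {q} {p′} {q′} eq = trans (sym (ℤ.pos-* p q)) (trans (cong +_ eq) (ℤ.pos-* p′ q′))

      by-yz : ∀ {i j} → y i ≡ y j → z i ≡ z j → i ≡ j
      by-yz {i} {j} p q = f-injective (cong₂ _,_
        (+-cancelˡ-≡ a _ _ (trans (a+x≡y+z i) (trans (cong₂ _+_ p q) (sym (a+x≡y+z j)))))
        (cong₂ _,_ p q))

      by-xz : ∀ {i j} → x i ≡ x j → z i ≡ z j → i ≡ j
      by-xz {i} {j} p q = by-yz {i} {j} (+-cancelʳ-≡ (z i) _ _
        (trans (sym (a+x≡y+z i)) (trans (cong (_+_ a) p) (trans (a+x≡y+z j) (cong (_+_ (y j)) (sym q)))))) q

      by-xy : ∀ {i j} → x i ≡ x j → y i ≡ y j → i ≡ j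
      by-xy {i} {j} p q = by-yz {i} {j} q (+-cancelˡ-≡ (y i) _ _
        (trans (sym (a+x≡y+z i)) (trans (cong (_+_ a) p) (trans (a+x≡y+z j) (cong (_+ z j) (sym q))))))

      constant : (u : Fin 3 → ℕ) → (∀ i → e * u i ≡ d * 1) → ∀ i → u i ≡ u 0F
      constant u eq i = *-cancelˡ-≡ _ _ e ⦃ >-nonZero e>0 ⦄ (trans (eq i) (sym (eq 0F)))

      sub≢0 : ∀ {p q} → p ≢ q → + p ℤ.- + q ≢ 0ℤ
      sub≢0 p≢q eq = p≢q (ℤ.+-injective (ℤ.i-j≡0⇒i≡j _ _ eq))

      e≢d : (u : Row → ℕ) → (u (f 0F) ≢ x 0F) → e * x 0F ≡ d * u (f 0F) → e ≢ d
      e≢d u u≢x eq refl = u≢x (sym (*-cancelˡ-≡ _ _ e ⦃ >-nonZero e>0 ⦄ eq))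

      y≢x : y 0F ≢ x 0F
      y≢x p = a≢z 0F (+-cancelʳ-≡ (x 0F) _ _ (trans (a+x≡y+z 0F)
        (trans (cong (_+ z 0F) p) (+-comm (x 0F) (z 0F)))))

      z≢x : z 0F ≢ x 0F
      z≢x p = a≢y 0F (+-cancelʳ-≡ (x 0F) _ _ (trans (a+x≡y+z 0F) (cong (_+_ (y 0F)) p)))

    -- The fibre condition eliminates one variable from a + x = y + z and leaves a line as in
    -- `no-three-solutions`. Its constant is nonzero since a > 0, a ≠ y and a ≠ z. On a fibre of x /
    -- y or x / z the coefficient e - d is nonzero since x ≠ y and x ≠ z.
    no-three-on-fibre : ∀ k → (∀ i → OnFibre (k , e , d) (f i)) → ⊥
    no-three-on-fibre x-fibre on = no-three-solutions {m} rigid cy>0 cz>0 {1ℤ} {1ℤ} {A ℤ.+ X 0F}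
      (λ ()) (λ ()) (λ eq → pos≢0 (≤-trans a>0 (m≤m+n a (x 0F))) (trans (ℤ.pos-+ a (x 0F)) eq))
      y z y>0 z>0 power-y power-z
      (λ i → begin
        1ℤ ℤ.* Y i ℤ.+ 1ℤ ℤ.* Z i  ≡⟨ cong₂ ℤ._+_ (ℤ.*-identityˡ (Y i)) (ℤ.*-identityˡ (Z i)) ⟩
        Y i ℤ.+ Z i                    ≡⟨ relation i ⟨
        A ℤ.+ X i                      ≡⟨ cong (λ u → A ℤ.+ + u) (constant x on i) ⟩
        A ℤ.+ X 0F                     ∎)
      by-yz
      where open ≡-Reasoning
    no-three-on-fibre y-fibre on = no-three-solutions {m} rigid cx>0 cz>0 {1ℤ} { -1ℤ} {Y 0F ℤ.- A}
      (λ ()) (λ ()) (sub≢0 (≢-sym (a≢y 0F)))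
      x z x>0 z>0 power-x power-z
      (λ i → begin
        1ℤ ℤ.* X i ℤ.+ -1ℤ ℤ.* Z i
          ≡⟨ solve 3 (λ a x z → con 1ℤ :* x :+ con -1ℤ :* z := (a :+ x) :- z :- a) refl A (X i) (Z i) ⟩
        (A ℤ.+ X i) ℤ.- Z i ℤ.- A       ≡⟨ cong (λ u → u ℤ.- Z i ℤ.- A) (relation i) ⟩
        (Y i ℤ.+ Z i) ℤ.- Z i ℤ.- A
          ≡⟨ solve 3 (λ a y z → (y :+ z) :- z :- a := y :- a) refl A (Y i) (Z i) ⟩
        Y i ℤ.- A                       ≡⟨ cong (λ u → + u ℤ.- A) (constant y on i) ⟩
        Y 0F ℤ.- A                      ∎)
      by-xz
      where open ≡-Reasoning
    no-three-on-fibre z-fibre on = no-three-solutions {m} rigid cx>0 cy>0 {1ℤ} { -1ℤ} {Z 0F ℤ.- A}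
      (λ ()) (λ ()) (sub≢0 (≢-sym (a≢z 0F)))
      x y x>0 y>0 power-x power-y
      (λ i → begin
        1ℤ ℤ.* X i ℤ.+ -1ℤ ℤ.* Y i
          ≡⟨ solve 3 (λ a x y → con 1ℤ :* x :+ con -1ℤ :* y := (a :+ x) :- y :- a) refl A (X i) (Y i) ⟩
        (A ℤ.+ X i) ℤ.- Y i ℤ.- A       ≡⟨ cong (λ u → u ℤ.- Y i ℤ.- A) (relation i) ⟩
        (Y i ℤ.+ Z i) ℤ.- Y i ℤ.- A
          ≡⟨ solve 3 (λ a y z → (y :+ z) :- y :- a := z :- a) refl A (Y i) (Z i) ⟩
        Z i ℤ.- A                       ≡⟨ cong (λ u → + u ℤ.- A) (constant z on i) ⟩
        Z 0F ℤ.- A                      ∎)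
      by-xy
      where open ≡-Reasoning
    no-three-on-fibre xy-fibre on = no-three-solutions {m} rigid cy>0 cz>0 {E ℤ.- D} {E} {E ℤ.* A}
      (sub≢0 (e≢d (proj₁ ∘ proj₂) y≢x (on 0F))) (pos≢0 e>0) (λ eq → pos≢0 (*-pos e>0 a>0) (trans (ℤ.pos-* e a) eq))
      y z y>0 z>0 power-y power-z
      (λ i → begin
        (E ℤ.- D) ℤ.* Y i ℤ.+ E ℤ.* Z i
          ≡⟨ solve 4 (λ e d y z → (e :- d) :* y :+ e :* z := e :* (y :+ z) :- d :* y) refl E D (Y i) (Z i) ⟩
        E ℤ.* (Y i ℤ.+ Z i) ℤ.- D ℤ.* Y i
          ≡⟨ cong₂ (λ u v → E ℤ.* u ℤ.- v) (sym (relation i)) (sym (+-eq {e} {x i} {d} {y i} (on i))) ⟩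
        E ℤ.* (A ℤ.+ X i) ℤ.- E ℤ.* X i
          ≡⟨ solve 3 (λ e a x → e :* (a :+ x) :- e :* x := e :* a) refl E A (X i) ⟩
        E ℤ.* A                              ∎)
      by-yz
      where open ≡-Reasoning
    no-three-on-fibre xz-fibre on = no-three-solutions {m} rigid cy>0 cz>0 {E} {E ℤ.- D} {E ℤ.* A}
      (pos≢0 e>0) (sub≢0 (e≢d (proj₂ ∘ proj₂) z≢x (on 0F))) (λ eq → pos≢0 (*-pos e>0 a>0) (trans (ℤ.pos-* e a) eq))
      y z y>0 z>0 power-y power-z
      (λ i → begin
        E ℤ.* Y i ℤ.+ (E ℤ.- D) ℤ.* Z i
          ≡⟨ solve 4 (λ e d y z → e :* y :+ (e :- d) :* z := e :* (y :+ z) :- d :* z) refl E D (Y i) (Z i) ⟩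
        E ℤ.* (Y i ℤ.+ Z i) ℤ.- D ℤ.* Z i
          ≡⟨ cong₂ (λ u v → E ℤ.* u ℤ.- v) (sym (relation i)) (sym (+-eq {e} {x i} {d} {z i} (on i))) ⟩
        E ℤ.* (A ℤ.+ X i) ℤ.- E ℤ.* X i
          ≡⟨ solve 3 (λ e a x → e :* (a :+ x) :- e :* x := e :* a) refl E A (X i) ⟩
        E ℤ.* A                              ∎)
      by-yz
      where open ≡-Reasoning
    no-three-on-fibre yz-fibre on = no-three-solutions {m} rigid cz>0 cx>0 {D ℤ.+ E} {ℤ.- E} {E ℤ.* A}
      (λ eq → pos≢0 (≤-trans e>0 (m≤n+m e d)) (trans (ℤ.pos-+ d e) eq))
      (λ eq → pos≢0 e>0 (ℤ.neg-injective eq)) (λ eq → pos≢0 (*-pos e>0 a>0) (trans (ℤ.pos-* e a) eq))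
      z x z>0 x>0 power-z power-x
      (λ i → begin
        (D ℤ.+ E) ℤ.* Z i ℤ.+ ℤ.- E ℤ.* X i
          ≡⟨ solve 4 (λ e d x z → (d :+ e) :* z :+ (:- e) :* x := d :* z :+ e :* z :- e :* x) refl E D (X i) (Z i) ⟩
        D ℤ.* Z i ℤ.+ E ℤ.* Z i ℤ.- E ℤ.* X i
          ≡⟨ cong (λ u → u ℤ.+ E ℤ.* Z i ℤ.- E ℤ.* X i) (+-eq {e} {y i} {d} {z i} (on i)) ⟨
        E ℤ.* Y i ℤ.+ E ℤ.* Z i ℤ.- E ℤ.* X i
          ≡⟨ cong (ℤ._- E ℤ.* X i) (ℤ.*-distribˡ-+ E (Y i) (Z i)) ⟨
        E ℤ.* (Y i ℤ.+ Z i) ℤ.- E ℤ.* X i              ≡⟨ cong (λ u → E ℤ.* u ℤ.- E ℤ.* X i) (relation i) ⟨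
        E ℤ.* (A ℤ.+ X i) ℤ.- E ℤ.* X i
          ≡⟨ solve 3 (λ e a x → e :* (a :+ x) :- e :* x := e :* a) refl E A (X i) ⟩
        E ℤ.* A                                        ∎)
      (λ p q → by-xz q p)
      where open ≡-Reasoning

  fibre-≤2 : ∀ {rs} → Unique rs → All Solution rs → ∀ k {e} d → 0 < e →
    length (filter (onFibre? (k , e , d)) rs) ≤ 2
  fibre-≤2 {rs} uniq sols k {e} d e>0 = length-≤2 (Unique.filter⁺ (onFibre? (k , e , d)) uniq) λ f inj f∈ →
    no-three-on-fibre d e>0 f inj
      (λ i → All.lookup sols (proj₁ (∈-filter⁻ (onFibre? (k , e , d)) {xs = rs} (f∈ i)))) k
      (λ i → proj₂ (∈-filter⁻ (onFibre? (k , e , d)) {xs = rs} (f∈ i)))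

  -- At most nine fibres, each containing at most two of the solutions, cannot cover 19 of them. The
  -- continuation receives a solution off all the fibres, which lets successive choices be chained.
  avoiding : ∀ {rs} → Unique rs → All Solution rs → 18 < length rs →
    (bs : List (Fibre × ℕ × ℕ)) → All (λ (_ , e , _) → 0 < e) bs → length bs ≤ 9 →
    (∀ r → Solution r → ¬ All (λ b → ¬ OnFibre b r) bs) → ⊥
  avoiding uniq sols long bs e>0 short continue =
    let r , r∈ , off = uncovered OnFibre onFibre? bs
          (All.map (λ {(k , e , d)} → fibre-≤2 uniq sols k d) e>0)
          (≤-<-trans (*-monoˡ-≤ 2 short) long)
    in continue r (All.lookup sols r∈) off

  module _ (r : Fin 4 → Row) (sol : ∀ i → Solution (r i)) where
    private
      module Sol i = IsSolution (sol i)
      open Sol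

      x y z : Fin 4 → ℕ
      x i = proj₁ (r i)
      y i = proj₁ (proj₂ (r i))
      z i = proj₂ (proj₂ (r i))

    -- The twelve odd terms are sorted by the column that supplies row 3, three for each column. In
    -- column z, the factor z₃ cancels and a condition on the first three rows remains. In column x
    -- or y, equality fixes x₃ / z₃ or y₃ / z₃; in the column of ones, it fixes z₃.
    diagonal-unmatched :
      ¬ OnFibre (x-fibre , 1 , x 0F) (r 1F) →
      ¬ OnFibre (y-fibre , 1 , y 0F) (r 2F) →
      ¬ OnFibre (xy-fibre , y 1F , x 1F) (r 2F) →
      All (λ b → ¬ OnFibre b (r 3F))
        ( (z-fibre , x 1F * y 2F , x 0F * y 1F * z 2F)
        ∷ (z-fibre , x 1F * y 2F , x 1F * y 2F * z 0F)
        ∷ (z-fibre , x 1F * y 2F , x 2F * y 0F * z 1F)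
        ∷ (xz-fibre , y 2F * z 1F , x 1F * y 2F)
        ∷ (xz-fibre , y 0F * z 2F , x 1F * y 2F)
        ∷ (xz-fibre , y 1F * z 0F , x 1F * y 2F)
        ∷ (yz-fibre , x 1F * z 2F , x 1F * y 2F)
        ∷ (yz-fibre , x 2F * z 0F , x 1F * y 2F)
        ∷ (yz-fibre , x 0F * z 1F , x 1F * y 2F) ∷ []) → ⊥
    diagonal-unmatched x₁ y₂ xy₂ (z₀₁ ∷ z₁₂ ∷ z₂₀ ∷ xz₂₁ ∷ xz₀₂ ∷ xz₁₀ ∷ yz₁₂ ∷ yz₂₀ ∷ yz₀₁ ∷ []) =
      let j , odd , eq = det₄-matched {m} rigid {a} cx>0 cy>0 cz>0 x y z x>0 y>0 z>0
            power-x power-y power-z a+x≡y+z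
      in cases (remQuot {2} 12 j) odd eq
      where
      z-last : ∀ {d} → x 1F * y 2F * z 3F ≡ d → x 1F * y 2F * z 3F ≡ d * 1
      z-last eq = trans eq (sym (*-identityʳ _))

      x-last : ∀ p q → x 1F * y 2F * z 3F ≡ x 3F * y p * z q → y p * z q * x 3F ≡ x 1F * y 2F * z 3F
      x-last p q eq = trans (*-comm (y p * z q) (x 3F)) (trans (sym (*-assoc (x 3F) (y p) (z q))) (sym eq))

      y-last : ∀ p q → x 1F * y 2F * z 3F ≡ x p * y 3F * z q → x p * z q * y 3F ≡ x 1F * y 2F * z 3F
      y-last p q eq = trans (xy∙z≈xz∙y (x p) (z q) (y 3F)) (sym eq)

      cancel-z₃ : ∀ {p q} → p * z 3F ≡ q * z 3F → p ≡ q
      cancel-z₃ = *-cancelʳ-≡ _ _ (z 3F) ⦃ >-nonZero (z>0 3F) ⦄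

      cases : ∀ k → let (s , p , q , r) = leibniz₄ k in
        s ≡ Sign.- → x 1F * y 2F * z 3F ≡ x p * y q * z r → ⊥
      cases (1F , 0F) _ eq = yz₁₂ (y-last 1F 2F eq)
      cases (1F , 1F) _ eq = xy₂ (trans (*-comm (y 1F) (x 2F)) (sym (cancel-z₃ eq)))
      cases (1F , 2F) _ eq = xz₂₁ (x-last 2F 1F eq)
      cases (1F , 3F) _ eq = x₁ (trans (*-comm 1 (x 1F)) (cong (_* 1)
        (*-cancelʳ-≡ (x 1F) (x 0F) (y 2F) ⦃ >-nonZero (y>0 2F) ⦄ (cancel-z₃ eq))))
      cases (1F , 4F) _ eq = yz₂₀ (y-last 2F 0F eq)
      cases (1F , 5F) _ eq = xz₀₂ (x-last 0F 2F eq)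
      cases (1F , 6F) _ eq = yz₀₁ (y-last 0F 1F eq)
      cases (1F , 7F) _ eq = y₂ (trans (*-comm 1 (y 2F)) (cong (_* 1)
        (*-cancelˡ-≡ _ _ (x 1F) ⦃ >-nonZero (x>0 1F) ⦄ (cancel-z₃ eq))))
      cases (1F , 8F) _ eq = xz₁₀ (x-last 1F 0F eq)
      cases (1F , 9F) _ eq = z₀₁ (z-last eq)
      cases (1F , suc 9F) _ eq = z₁₂ (z-last eq)
      cases (1F , suc (suc 9F)) _ eq = z₂₀ (z-last eq)

  solutions-≤18 : ∀ {rs} → Unique rs → All Solution rs → length rs ≤ 18
  solutions-≤18 {rs} uniq sols = ≮⇒≥ λ long →
    -- The four rows are chosen in turn, avoiding 0, 1, 2 and finally 9 fibres determined by the
    -- earlier rows; the last choice accounts for 18 = 2 · 9.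
    avoiding uniq sols long [] [] z≤n λ r₀ s₀ _ → pick₁ long r₀ s₀
    where
    open IsSolution

    pick₃ : 18 < length rs → ∀ r₀ → Solution r₀ → ∀ r₁ → Solution r₁ →
      ¬ OnFibre (x-fibre , 1 , proj₁ r₀) r₁ → ∀ r₂ → Solution r₂ →
      ¬ OnFibre (y-fibre , 1 , proj₁ (proj₂ r₀)) r₂ →
      ¬ OnFibre (xy-fibre , proj₁ (proj₂ r₁) , proj₁ r₁) r₂ → ⊥
    pick₃ long r₀@(x₀ , y₀ , z₀) s₀ r₁@(x₁ , y₁ , z₁) s₁ off-x₁ r₂@(x₂ , y₂ , z₂) s₂ off-y₂ off-xy₂ =
      avoiding uniq sols long
        ( (z-fibre , x₁ * y₂ , x₀ * y₁ * z₂)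
        ∷ (z-fibre , x₁ * y₂ , x₁ * y₂ * z₀)
        ∷ (z-fibre , x₁ * y₂ , x₂ * y₀ * z₁)
        ∷ (xz-fibre , y₂ * z₁ , x₁ * y₂)
        ∷ (xz-fibre , y₀ * z₂ , x₁ * y₂)
        ∷ (xz-fibre , y₁ * z₀ , x₁ * y₂)
        ∷ (yz-fibre , x₁ * z₂ , x₁ * y₂)
        ∷ (yz-fibre , x₂ * z₀ , x₁ * y₂)
        ∷ (yz-fibre , x₀ * z₁ , x₁ * y₂) ∷ [])
        ( *-pos (x>0 s₁) (y>0 s₂) ∷ *-pos (x>0 s₁) (y>0 s₂) ∷ *-pos (x>0 s₁) (y>0 s₂)
        ∷ *-pos (y>0 s₂) (z>0 s₁) ∷ *-pos (y>0 s₀) (z>0 s₂) ∷ *-pos (y>0 s₁) (z>0 s₀)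
        ∷ *-pos (x>0 s₁) (z>0 s₂) ∷ *-pos (x>0 s₂) (z>0 s₀) ∷ *-pos (x>0 s₀) (z>0 s₁) ∷ [])
        ≤-refl
        λ r₃ s₃ → diagonal-unmatched (lookup (r₀ ∷ r₁ ∷ r₂ ∷ r₃ ∷ []))
          (λ { 0F → s₀ ; 1F → s₁ ; 2F → s₂ ; 3F → s₃ })
          off-x₁ off-y₂ off-xy₂

    pick₂ : 18 < length rs → ∀ r₀ → Solution r₀ → ∀ r₁ → Solution r₁ →
      ¬ OnFibre (x-fibre , 1 , proj₁ r₀) r₁ → ⊥
    pick₂ long r₀@(_ , y₀ , _) s₀ r₁@(x₁ , y₁ , _) s₁ off-x₁ = avoiding uniq sols long
      ((y-fibre , 1 , y₀) ∷ (xy-fibre , y₁ , x₁) ∷ []) (z<s ∷ y>0 s₁ ∷ []) (s≤s (s≤s z≤n))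
      λ { r₂ s₂ (off-y₂ ∷ off-xy₂ ∷ []) → pick₃ long r₀ s₀ r₁ s₁ off-x₁ r₂ s₂ off-y₂ off-xy₂ }

    pick₁ : 18 < length rs → ∀ r₀ → Solution r₀ → ⊥
    pick₁ long r₀ s₀ = avoiding uniq sols long ((x-fibre , 1 , proj₁ r₀) ∷ []) (z<s ∷ []) (s≤s z≤n)
      λ { r₁ s₁ (off-x₁ ∷ []) → pick₂ long r₀ s₀ r₁ s₁ off-x₁ }

-- Sums with few representations

Nontrivial : ℕ → ℕ × ℕ × ℕ → Set
Nontrivial a (x , y , z) = a + x ≡ y + z × a ≢ y × a ≢ z

nontrivial? : ∀ a r → Dec (Nontrivial a r)
nontrivial? a (x , y , z) = a + x ≟ y + z ×-dec (¬? (a ≟ y) ×-dec ¬? (a ≟ z))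

module _ (m : ℕ) (S : List ℕ) where

  R : List ℕ
  R = reps m S

  r n : ℕ
  r = length R
  n = length S

  R³ : List (ℕ × ℕ × ℕ)
  R³ = cartesianProduct R (cartesianProduct R R)

  rows : ℕ → List (ℕ × ℕ × ℕ)
  rows a = filter (nontrivial? a) (cartesianProduct S (cartesianProduct S S))

  ∈-rows⁻ : ∀ a {x y z} → (x , y , z) ∈ rows a →
    (x ∈ S × y ∈ S × z ∈ S) × Nontrivial a (x , y , z)
  ∈-rows⁻ a ∈r
    with ∈S³ , nontrivial ← ∈-filter⁻ (nontrivial? a) {xs = cartesianProduct S (cartesianProduct S S)} ∈r
    with x∈ , ∈S² ← ∈-cartesianProduct⁻ S (cartesianProduct S S) ∈S³
    with y∈ , z∈ ← ∈-cartesianProduct⁻ S S ∈S² = (x∈ , y∈ , z∈) , nontrivial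

  SameClass³ : ℕ × ℕ × ℕ → ℕ × ℕ × ℕ → Set
  SameClass³ (ρ , σ , τ) (x , y , z) = SameClass m ρ x × SameClass m σ y × SameClass m τ z

  sameClass³? : ∀ ρ u → Dec (SameClass³ ρ u)
  sameClass³? (ρ , σ , τ) (x , y , z) =
    sameClass? m ρ x ×-dec (sameClass? m σ y ×-dec sameClass? m τ z)

  Bad : ℕ × ℕ → Set
  Bad (a , x) = x ∈ map proj₁ (rows a)

  bad? : ∀ u → Dec (Bad u)
  bad? (a , x) = x ∈? map proj₁ (rows a)

  S² bad good : List (ℕ × ℕ)
  S² = cartesianProduct S S
  bad = filter bad? S²
  good = filter (¬? ∘ bad?) S²

  module _ (rigid : Rigid (suc m)) (S-unique : Unique S) (S>0 : All (0 <_) S) where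

    rows-unique : ∀ a → Unique (rows a)
    rows-unique a = Unique.filter⁺ (nontrivial? a)
      (Unique.cartesianProduct⁺ S-unique (Unique.cartesianProduct⁺ S-unique S-unique))

    -- The r³ triples of representatives cover all rows, and each triple accounts for at most 18 of
    -- them.
    length-rows : ∀ {a} → a ∈ S → length (rows a) ≤ r * (r * r) * 18
    length-rows {a} a∈ = subst (λ k → length (rows a) ≤ k * 18)
      (trans (length-cartesianProduct R (cartesianProduct R R)) (cong (r *_) (length-cartesianProduct R R)))
      (length-cover SameClass³ sameClass³? R³ class-≤18 cover)
      where
      positive : ∀ {s} → s ∈ S → 0 < s
      positive = All.lookup S>0

      rep^>0 : ∀ {ρ} → ρ ∈ R → 0 < ρ ^ m
      rep^>0 {ρ} ρ∈ = m^n>0 ρ ⦃ >-nonZero (positive (reps-⊆ m S ρ∈)) ⦄ m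

      class-≤18 : ∀ {κ} → κ ∈ R³ → length (filter (sameClass³? κ) (rows a)) ≤ 18
      class-≤18 {κ@(ρ , σ , τ)} κ∈
        with ρ∈ , στ∈ ← ∈-cartesianProduct⁻ R (cartesianProduct R R) κ∈
        with σ∈ , τ∈ ← ∈-cartesianProduct⁻ R R στ∈ =
        solutions-≤18 {m} rigid {a} (positive a∈) (rep^>0 ρ∈) (rep^>0 σ∈) (rep^>0 τ∈)
          (Unique.filter⁺ (sameClass³? κ) (rows-unique a)) (All.tabulate solution)
        where
        solution : ∀ {u} → u ∈ filter (sameClass³? κ) (rows a) →
          IsSolution (suc m) a (ρ ^ m) (σ ^ m) (τ ^ m) u
        solution {_ , _ , _} u∈
          with u∈rows , (px , py , pz) ← ∈-filter⁻ (sameClass³? κ) {xs = rows a} u∈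
          with (x∈ , y∈ , z∈) , (rel , a≢y , a≢z) ← ∈-rows⁻ a u∈rows = record
          { x>0 = positive x∈ ; y>0 = positive y∈ ; z>0 = positive z∈
          ; power-x = px ; power-y = py ; power-z = pz
          ; a+x≡y+z = rel ; a≢y = a≢y ; a≢z = a≢z }

      rep : ∀ {s} → s ∈ S → ∃[ ρ ] ρ ∈ R × SameClass m ρ s
      rep s∈ = find (All.lookup (reps-cover m S) s∈)

      cover : ∀ {u} → u ∈ rows a → ∃[ κ ] κ ∈ R³ × SameClass³ κ u
      cover {_ , _ , _} u∈ with (x∈ , y∈ , z∈) , _ ← ∈-rows⁻ a u∈
        with ρ , ρ∈ , px ← rep x∈ | σ , σ∈ , py ← rep y∈ | τ , τ∈ , pz ← rep z∈ =
        (ρ , σ , τ) , ∈-cartesianProduct⁺ ρ∈ (∈-cartesianProduct⁺ σ∈ τ∈) , px , py , pz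

    -- For fixed a, each bad pair (a , x) is the image of some row of a under its first coordinate.
    length-bad : length bad ≤ n * (r * (r * r) * 18)
    length-bad = length-cover (λ a u → a ≡ proj₁ u) (λ a u → a ≟ proj₁ u) S per-element λ {u} u∈ →
      proj₁ u , proj₁ (∈-cartesianProduct⁻ S S (proj₁ (∈-filter⁻ bad? {xs = S²} u∈))) , refl
      where
      per-element : ∀ {a} → a ∈ S → length (filter (λ u → a ≟ proj₁ u) bad) ≤ r * (r * r) * 18
      per-element {a} a∈ = begin
        length (filter (λ u → a ≟ proj₁ u) bad)
          ≤⟨ unique-⊆⇒length-≤ (Unique.filter⁺ (λ u → a ≟ proj₁ u)
               (Unique.filter⁺ bad? (Unique.cartesianProduct⁺ S-unique S-unique))) sub ⟩
        length (map (λ u → a , proj₁ u) (rows a))   ≡⟨ length-map (λ u → a , proj₁ u) (rows a) ⟩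
        length (rows a)                   ≤⟨ length-rows a∈ ⟩
        r * (r * r) * 18                  ∎
        where
        open ≤-Reasoning
        sub : filter (λ u → a ≟ proj₁ u) bad ⊆ map (λ u → a , proj₁ u) (rows a)
        sub {_ , x} u∈ with u∈bad , refl ← ∈-filter⁻ (λ u → a ≟ proj₁ u) {xs = bad} u∈
          with _ , x∈ ← ∈-filter⁻ bad? {xs = S²} u∈bad
          with v , v∈ , refl ← ∈-map⁻ proj₁ x∈ = ∈-map⁺ (λ u → a , proj₁ u) v∈

    -- Any pair with the same sum as a good pair is that pair or its swap. Of three good pairs with
    -- one sum, the last two would thus either meet the first or both be its swap.
    length-good : ∀ {T} → (∀ {a x} → a ∈ S → x ∈ S → a + x ∈ T) → length good ≤ length T * 2
    length-good {T} sum∈ = length-cover SumsTo sumsTo? T {good}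
      (λ {t} _ → length-≤2
        (Unique.filter⁺ (sumsTo? t) (Unique.filter⁺ (¬? ∘ bad?) (Unique.cartesianProduct⁺ S-unique S-unique)))
        (λ f f-injective f∈ → two-representations f f-injective (λ i → good-pair (f∈ i))))
      λ {(a , x)} u∈ → let u∈S² , _ = ∈-filter⁻ (¬? ∘ bad?) {xs = S²} u∈
                           a∈ , x∈ = ∈-cartesianProduct⁻ S S u∈S²
                       in a + x , sum∈ a∈ x∈ , refl
      where
      SumsTo : ℕ → ℕ × ℕ → Set
      SumsTo t (a , x) = a + x ≡ t

      sumsTo? : ∀ t u → Dec (SumsTo t u)
      sumsTo? t (a , x) = a + x ≟ t

      GoodPair : ℕ → ℕ × ℕ → Set
      GoodPair t (a , x) = a ∈ S × x ∈ S × ¬ Bad (a , x) × a + x ≡ t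

      good-pair : ∀ {t u} → u ∈ filter (sumsTo? t) good → GoodPair t u
      good-pair {t} {a , x} u∈ =
        let u∈good , sum = ∈-filter⁻ (sumsTo? t) {xs = good} u∈
            u∈S² , ¬bad = ∈-filter⁻ (¬? ∘ bad?) {xs = S²} u∈good
            a∈ , x∈ = ∈-cartesianProduct⁻ S S u∈S²
        in a∈ , x∈ , ¬bad , sum

      same-or-swapped : ∀ {t u v} → GoodPair t u → GoodPair t v → u ≡ v ⊎ v ≡ swap u
      same-or-swapped {u = a , x} {y , z} (a∈ , x∈ , ¬bad , p) (y∈ , z∈ , _ , q) with a ≟ y | a ≟ z
      ... | yes refl | _ = inj₁ (cong (a ,_) (+-cancelˡ-≡ a _ _ (trans p (sym q))))
      ... | no _ | yes refl = inj₂ (cong (_, a) (+-cancelʳ-≡ a _ _ (trans q (trans (sym p) (+-comm a x)))))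
      ... | no a≢y | no a≢z = contradiction
        (∈-map⁺ proj₁ (∈-filter⁺ (nontrivial? a) (∈-cartesianProduct⁺ x∈ (∈-cartesianProduct⁺ y∈ z∈))
          (trans p (sym q) , a≢y , a≢z))) ¬bad

      two-representations : ∀ {t} (f : Fin 3 → ℕ × ℕ) → (∀ {i j} → f i ≡ f j → i ≡ j) →
        (∀ i → GoodPair t (f i)) → ⊥
      two-representations f f-injective gp
        with same-or-swapped (gp 0F) (gp 1F) | same-or-swapped (gp 0F) (gp 2F)
      ... | inj₁ p | _ = contradiction (f-injective p) λ ()
      ... | inj₂ _ | inj₁ q = contradiction (f-injective q) λ ()
      ... | inj₂ p | inj₂ q = contradiction (f-injective (trans p (sym q))) λ ()

    length²-≤ : ∀ {T} → (∀ {a x} → a ∈ S → x ∈ S → a + x ∈ T) →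
      36 * (r * (r * r)) ≤ n → n * n ≤ 4 * length T
    length²-≤ {T} sum∈ few = square-≤ {g = length good} {r * (r * r)} {length T}
      (trans (sym (length-cartesianProduct S S)) (sym (length-filter-¬ bad? S²)))
      length-bad (length-good sum∈) few

-- Rational constants and the assembled bound

¼ : ℚ
¼ = mkℚ (ℤ.+ 1) 3 (1-coprimeTo 4)

-- Passing to unnormalised rationals, where no reduction to lowest terms intervenes, turns the claim
-- into the cross-multiplied hypothesis.
¼*-≤ : ∀ {a b} → a ≤ 4 * b → ¼ *ℚ fromℕ a ≤ℚ fromℕ b
¼*-≤ {a} {b} a≤4b = ℚ.toℚᵘ-cancel-≤ (begin
  ℚ.toℚᵘ (¼ *ℚ fromℕ a)                       ≃⟨ ℚ.toℚᵘ-homo-* ¼ (fromℕ a) ⟩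
  ℚ.toℚᵘ ¼ ℚᵘ.* ℚ.toℚᵘ (fromℕ a)              ≃⟨ ℚᵘ.*-congˡ {ℚ.toℚᵘ ¼} (ℚ.toℚᵘ-fromℚᵘ (mkℚᵘ (ℤ.+ a) 0)) ⟩
  mkℚᵘ (ℤ.+ 1) 3 ℚᵘ.* mkℚᵘ (ℤ.+ a) 0          ≤⟨ *≤* scaled ⟩
  mkℚᵘ (ℤ.+ b) 0                              ≃⟨ ℚ.toℚᵘ-fromℚᵘ (mkℚᵘ (ℤ.+ b) 0) ⟨
  ℚ.toℚᵘ (fromℕ b)                            ∎)
  where
  open ℚᵘ.≤-Reasoning
  scaled : (ℤ.+ 1 ℤ.* ℤ.+ a) ℤ.* ℤ.+ 1 ℤ.≤ ℤ.+ b ℤ.* ℤ.+ 4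
  scaled = subst₂ ℤ._≤_
    (sym (trans (ℤ.*-identityʳ _) (ℤ.*-identityˡ (ℤ.+ a))))
    (trans (cong ℤ.+_ (*-comm 4 b)) (ℤ.pos-* b 4)) (ℤ.+≤+ a≤4b)

theorem2 : Conjecture →
    Σ[ c ∈ ℚ ] Σ[ C ∈ ℚ ] Σ[ n₀ ∈ ℕ ] (0ℚ <ℚ c × 0ℚ <ℚ C ×
    ((n : ℕ) → n₀ ≤ n → (S : FinSet) → AllPositive S → ∣ S ∣ ≡ n →
    ∣ S ⊙ S ∣ < n ^[1+ c ] →
    C *ℚ fromℕ (n ^ 2) ≤ℚ fromℕ ∣ S ⊕ S ∣))
theorem2 (m , conjecture) =
  -- With m the threshold of the conjecture, only the exponent m + 1 is used, so that `c` depends on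
  -- m alone.
  c , ¼ , 36 ^ 4 , ℚ.positive⁻¹ c , ℚ.positive⁻¹ ¼ , λ { _ n₀≤n S S>0 refl small →
    ¼*-≤ {∣ S ∣ ^ 2} {∣ S ⊕ S ∣} (subst (_≤ 4 * ∣ S ⊕ S ∣) (cong (∣ S ∣ *_) (sym (*-identityʳ ∣ S ∣)))
      (length²-≤ m (elements S) (conjecture (suc m) (n≤1+n m)) (unique S) S>0
        (λ a∈ x∈ → ∈-deduplicate⁺ _≟_ (∈-cartesianProductWith⁺ _+_ a∈ x∈))
        (few-classes {length (reps m (elements S))} n₀≤n (fourth-power-< {P = ∣ S ⊙ S ∣} k
          (reps-bound m (unique S) S>0 (n>0 n₀≤n)) small)))) }
  where
  k : ℕ
  k = suc (suc m)

  c : ℚ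
  -- `mkℚ` takes the denominator minus one. Here `suc (suc m + 3 * k)` is `4 * k`, so c = 1 / (4k),
  -- where k = m + 2 is the exponent in `reps-bound`.
  c = mkℚ (ℤ.+ 1) (suc m + 3 * k) (1-coprimeTo (4 * k))

  n>0 : ∀ {n} → 36 ^ 4 ≤ n → 0 < n
  n>0 = ≤-trans z<s
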